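{- Let $G$ be a connected $K_{1,5}$-free graph with $n$ vertices. If $\sigma_4(G)\geq n-1$, then $G$ contains a spanning tree $T$ with at most $5$ leaves and branch vertices in total, i.e. $|L(T)|+|B(T)|\leq 5$.
   Context: All graphs are finite and simple. $d(v)$ denotes the degree of $v$ in $G$. A set $X\subseteq V(G)$ is independent if no two vertices of $X$ are adjacent in $G$. For $k\geq 1$, $\sigma_k(G)=\min\{\sum_{i=1}^k d(v_i) : \{v_1,\ldots,v_k\}\text{ is an independent set of } k \text{ distinct vertices of } G\}$, with the convention $\sigma_k(G)=+\infty$ if $G$ has no independent set of size $k$. A graph is $K_{1,r}$-free if it does not contain $K_{1,r}$ as an induced subgraph. For a tree $T$, a leaf is a vertex of degree one in $T$ and a branch vertex is a vertex of degree at least three in $T$; $L(T)$ is the set of leaves and $B(T)$ is the set of branch vertices of $T$. -}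

module Defs where

open import Data.Empty using (⊥)
open import Data.Fin using (Fin; zero; suc; inject₁; fromℕ)
open import Data.Fin.Properties using (all?)
open import Data.Fin.Subset using (Subset; inside; outside; _∈_; ∣_∣)
open import Data.Fin.Subset.Properties using (_∈?_)
open import Data.List using (List; []; _∷_; map; filter; allFin; cartesianProductWith)
import Data.List.Extrema as Extrema
open import Data.Nat.ListAction using (sum)
open import Data.Nat using (ℕ; zero; suc; _+_; _≤_; _≟_; _≤?_)
open import Data.Nat.Properties using (≤-isTotalOrder)
open import Data.Product using (∃-syntax; _×_)
open import Data.Unit using (⊤; tt)
import Data.Vec as Vec
open import Function using (Injective; _⇔_)
open import Level using (0ℓ)
open import Relation.Binary using (Rel; Decidable; Symmetric; Irreflexive; TotalOrder; _⇒_)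
import Relation.Binary.Construct.Add.Supremum.NonStrict as Supremum
open import Relation.Binary.Construct.Closure.ReflexiveTransitive using (Star)
open import Relation.Binary.PropositionalEquality using (_≡_; refl)
open import Relation.Nullary using (¬_; Dec; yes; no; does; ¬?; _×-dec_; _→-dec_)
open import Relation.Nullary.Construct.Add.Supremum using (_⁺; ⊤⁺; [_]) public

-- A finite simple graph on the vertex set Fin n.
record Graph (n : ℕ) : Set₁ where
  field
    Adj    : Rel (Fin n) 0ℓ
    adj?   : Decidable Adj
    sym    : Symmetric Adj
    irrefl : Irreflexive _≡_ Adj

open Graph public using (Adj; adj?)

private
  variable
    m n : ℕ

N : Graph n → Fin n → Subset n
N G v = Vec.tabulate (λ w → does (adj? G v w))

degree : Graph n → Fin n → ℕ
degree G v = ∣ N G v ∣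

-- The graph without vertices is not regarded as connected.
Connected : Graph n → Set
Connected {n} G = Fin n × (∀ u v → Star (Adj G) u v)

record Cycle (G : Graph n) : Set where
  field
    -- The cycle has 3 + k vertices.
    k         : ℕ
    vertex    : Fin (3 + k) → Fin n
    distinct  : Injective _≡_ _≡_ vertex
    step      : ∀ (i : Fin (2 + k)) → Adj G (vertex (inject₁ i)) (vertex (suc i))
    closing   : Adj G (vertex (fromℕ (2 + k))) (vertex zero)

IsTree : Graph n → Set
IsTree T = Connected T × ¬ Cycle T

-- Sharing the index n makes the subgraph T spanning.
_IsSpanningTreeOf_ : Graph n → Graph n → Set
T IsSpanningTreeOf G = IsTree T × (Adj T ⇒ Adj G)

L : Graph n → Subset n
L T = Vec.tabulate (λ v → does (degree T v ≟ 1))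

B : Graph n → Subset n
B T = Vec.tabulate (λ v → does (3 ≤? degree T v))

ContainsInduced : Graph m → Graph n → Set
ContainsInduced {m} {n} H G =
  ∃[ f ] Injective {A = Fin m} {B = Fin n} _≡_ _≡_ f
       × (∀ i j → Adj H i j ⇔ Adj G (f i) (f j))

-- K_{1,r}, with centre zero.
K₁ : (r : ℕ) → Graph (suc r)
K₁ r = record { Adj = A ; adj? = A? ; sym = λ {i} {j} → A-sym i j ; irrefl = A-irrefl _ }
  where
  A : Rel (Fin (suc r)) 0ℓ
  A zero    zero    = ⊥
  A zero    (suc _) = ⊤
  A (suc _) zero    = ⊤
  A (suc _) (suc _) = ⊥

  A? : Decidable A
  A? zero    zero    = no λ ()
  A? zero    (suc _) = yes tt
  A? (suc _) zero    = yes tt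
  A? (suc _) (suc _) = no λ ()

  A-sym : ∀ i j → A i j → A j i
  A-sym zero    (suc _) _ = tt
  A-sym (suc _) zero    _ = tt

  A-irrefl : ∀ i {j} → i ≡ j → ¬ A i j
  A-irrefl zero    refl ()
  A-irrefl (suc _) refl ()

K₁,_-Free : ℕ → Graph n → Set
K₁, r -Free G = ¬ ContainsInduced (K₁ r) G

Independent : Graph n → Subset n → Set
Independent G X = ∀ u v → u ∈ X → v ∈ X → ¬ Adj G u v

independent? : (G : Graph n) (X : Subset n) → Dec (Independent G X)
independent? G X =
  all? λ u → all? λ v → (u ∈? X) →-dec ((v ∈? X) →-dec ¬? (adj? G u v))

subsets : ∀ n → List (Subset n)
subsets zero    = Vec.[] ∷ []
subsets (suc n) = cartesianProductWith Vec._∷_ (inside ∷ outside ∷ []) (subsets n)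

independentSets : (G : Graph n) (k : ℕ) → List (Subset n)
independentSets {n} G k =
  filter (λ X → independent? G X ×-dec (∣ X ∣ ≟ k)) (subsets n)

degreeSum : Graph n → Subset n → ℕ
degreeSum {n} G X = sum (map (degree G) (filter (_∈? X) (allFin n)))

open Supremum _≤_ public using (_≤⁺_)

-- ℕ ⁺ is ℕ ∪ {+∞}, with ⊤⁺ as +∞.
ℕ⁺-totalOrder : TotalOrder 0ℓ 0ℓ 0ℓ
ℕ⁺-totalOrder = record { isTotalOrder = Supremum.≤⁺-isTotalOrder-≡ _≤_ ≤-isTotalOrder }

-- The default value ⊤⁺ makes σ k G = +∞ when G has no independent k-set.
σ : (k : ℕ) → Graph n → ℕ ⁺
σ k G = Extrema.min ℕ⁺-totalOrder ⊤⁺ (map (λ X → [ degreeSum G X ]) (independentSets G k))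

{-# OPTIONS --safe #-}
module Submission where

-- A spider, i.e. a tree consisting of a hub and at most four legs, has at most four leaves and one branch vertex,
-- so a spanning spider suffices. Suppose there is none. Among all trees in G that are spiders or consist of two
-- hubs joined by a trunk, with two legs at each hub, take one whose vertex set V is as large as possible. Its
-- leaves x₁, …, x₄ are independent and have all their neighbours in V, and one shows that their degrees add up to
-- at most n − 2.
--
-- If V carries a spider, then V ≠ V(G), and V carries no spider with three legs, since to that one any outer vertex
-- could be attached. Reroutings that would produce three legs show, for a vertex u on the leg A of x₁ adjacent to
-- another leaf, that the predecessor of u is not adjacent to x₁, and to no leaf at all if u is adjacent to two
-- others. K₁,₅-freeness excludes three others, and it implies that a vertex adjacent to x₁ and two other leaves
-- occurs at most once on A and prevents x₁ from being adjacent to the centre. So there are at most |A| edges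
-- between A and the leaves, including the one from x₁ to the centre, and in total at most |V| − 1.
--
-- If V carries no spider, take the trunk P as long as possible. Reroutings into a spider or a longer trunk are
-- impossible, which leaves at most |A| edges for every leg A and at most |P| for the trunk, in total at most |V| − 2.

open import Defs
import Algebra.Solver.CommutativeMonoid
open import Data.Empty using (⊥; ⊥-elim)
import Data.Fin as Fin
open import Data.Fin using (Fin; zero; suc; inject₁; fromℕ)
import Data.Fin.Properties as Fin
open import Data.Fin.Properties using (any?)
open import Data.Fin.Relation.Unary.Top using (view; ‵fromℕ; ‵inject₁)
open import Data.Fin.Subset using (Subset; inside; outside; ∣_∣) renaming (_∈_ to _∈ˢ_)
open import Data.Fin.Subset.Properties using () renaming (_∈?_ to _∈ˢ?_)
import Data.List as List
open import Data.List
  using (List; []; _∷_; _++_; length; lookup; map; filter; allFin)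
import Data.List.Extrema as Extrema
open import Data.List.Membership.Propositional using (_∈_; _∉_)
open import Data.List.Membership.Propositional.Properties
  using (∈-++⁺ˡ; ∈-++⁺ʳ; ∈-++⁻; ∈-∃++; ∈-filter⁺; ∈-filter⁻; ∈-allFin; ∈-lookup; ∈-map⁺;
         ∈-cartesianProductWith⁺)
import Data.List.Membership.DecPropositional as DecMembership
open import Data.List.Properties
  using (++-assoc; filter-all; length-++; length-tabulate; map-++; map-cong)
open import Data.List.Relation.Binary.Permutation.Propositional
  using (_↭_; prep; ↭-refl; ↭-sym; ↭-trans; ↭⇒↭ₛ)
import Data.List.Relation.Binary.Permutation.Propositional.Properties as Perm
import Data.List.Relation.Binary.Permutation.Setoid.Properties as PermS
open import Data.List.Relation.Unary.All as All using (All; []; _∷_)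
open import Data.List.Relation.Unary.All.Properties using (all-filter; ¬Any⇒All¬)
open import Data.List.Relation.Unary.AllPairs using (AllPairs; []; _∷_; allPairs?)
open import Data.List.Relation.Unary.Any using (here; there)
open import Data.List.Relation.Unary.Linked using (Linked; []; [-]; _∷_; linked?)
open import Data.List.Relation.Unary.Unique.Propositional using (Unique)
import Data.List.Relation.Unary.Unique.Propositional.Properties as Unique
open import Data.Nat using (ℕ; zero; suc; _+_; _∸_; _≤_; _<_; _≟_; _≤?_; z≤n; s≤s)
open import Data.Nat.ListAction using (sum)
open import Data.Nat.ListAction.Properties using (sum-++; sum-↭)
import Data.Nat.Properties as ℕ
open import Data.Nat.Tactic.RingSolver using (solve-∀)
open import Data.Product using (∃-syntax; _×_; _,_; proj₁; proj₂)
open import Data.Sum using (_⊎_; inj₁; inj₂; [_,_]′)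
open import Data.Unit using (⊤; tt)
import Data.Vec as Vec
import Data.Vec.Properties as Vec
open import Function using (Injective; mk⇔; _∘_)
open import Relation.Binary using (TotalOrder)
import Relation.Binary.Construct.Add.Supremum.NonStrict as Supremum
open import Relation.Binary.Construct.Closure.ReflexiveTransitive as Star using (Star; ε; _◅_; _◅◅_)
open import Relation.Binary.PropositionalEquality
  using (_≡_; _≢_; refl; sym; trans; cong; cong₂; subst; setoid)
open import Relation.Nullary using (¬_; Dec; yes; no; does; ¬?; map′; _×-dec_; _⊎-dec_)
open import Relation.Nullary.Decidable using (decidable-stable; dec-true)
open import Relation.Unary using (Decidable)

-- Counting along lists

private
  variable
    Φ Ψ Ω : Set

⟦_⟧ : Dec Φ → ℕ
⟦ yes _ ⟧ = 1
⟦ no _ ⟧  = 0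

⟦⟧≤1 : (p : Dec Φ) → ⟦ p ⟧ ≤ 1
⟦⟧≤1 (yes _) = s≤s z≤n
⟦⟧≤1 (no _)  = z≤n

⟦⟧≡0 : (p : Dec Φ) → ¬ Φ → ⟦ p ⟧ ≡ 0
⟦⟧≡0 (yes x) ¬x = ⊥-elim (¬x x)
⟦⟧≡0 (no _)  _  = refl

one-of : (p : Dec Φ) (q : Dec Ψ) (r : Dec Ω) → 1 ≤ ⟦ p ⟧ + ⟦ q ⟧ + ⟦ r ⟧ → Φ ⊎ Ψ ⊎ Ω
one-of (yes x) _       _       _ = inj₁ x
one-of (no _)  (yes y) _       _ = inj₂ (inj₁ y)
one-of (no _)  (no _)  (yes z) _ = inj₂ (inj₂ z)

two-of : (p : Dec Φ) (q : Dec Ψ) (r : Dec Ω) → ⟦ p ⟧ + ⟦ q ⟧ + ⟦ r ⟧ ≡ 2 → Φ × Ψ ⊎ Φ × Ω ⊎ Ψ × Ω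
two-of (yes x) (yes y) (no _)  _ = inj₁ (x , y)
two-of (yes x) (no _)  (yes z) _ = inj₂ (inj₁ (x , z))
two-of (no _)  (yes y) (yes z) _ = inj₂ (inj₂ (y , z))
two-of (no _)  (no _)  (yes _) ()
two-of (no _)  (no _)  (no _)  ()

at-most-two : (p : Dec Φ) (q : Dec Ψ) (r : Dec Ω) → ¬ (Φ × Ψ × Ω) → ⟦ p ⟧ + ⟦ q ⟧ + ⟦ r ⟧ ≤ 2
at-most-two (yes x) (yes y) (yes z) ¬xyz = ⊥-elim (¬xyz (x , y , z))
at-most-two (yes _) (yes _) (no _)  _ = s≤s (s≤s z≤n)
at-most-two (yes _) (no _)  r       _ = s≤s (⟦⟧≤1 r)
at-most-two (no _)  (yes _) r       _ = s≤s (⟦⟧≤1 r)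
at-most-two (no _)  (no _)  r       _ = ℕ.m≤n⇒m≤1+n (⟦⟧≤1 r)

at-most-one : (p : Dec Φ) (q : Dec Ψ) (r : Dec Ω) → ¬ (Φ × Ψ) → ¬ (Φ × Ω) → ¬ (Ψ × Ω) → ⟦ p ⟧ + ⟦ q ⟧ + ⟦ r ⟧ ≤ 1
at-most-one (yes x) (yes y) _       ¬xy _   _   = ⊥-elim (¬xy (x , y))
at-most-one (yes x) (no _)  (yes z) _   ¬xz _   = ⊥-elim (¬xz (x , z))
at-most-one (yes _) (no _)  (no _)  _   _   _   = s≤s z≤n
at-most-one (no _)  (yes y) (yes z) _   _   ¬yz = ⊥-elim (¬yz (y , z))
at-most-one (no _)  (yes _) (no _)  _   _   _   = s≤s z≤n
at-most-one (no _)  (no _)  r       _   _   _   = ⟦⟧≤1 r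

sum-zero : (p : Dec Φ) (q : Dec Ψ) → ¬ Φ → ¬ Ψ → ⟦ p ⟧ + ⟦ q ⟧ ≡ 0
sum-zero p q ¬p ¬q rewrite ⟦⟧≡0 p ¬p | ⟦⟧≡0 q ¬q = refl

both : (p : Dec Φ) (q : Dec Ψ) → ⟦ p ⟧ + ⟦ q ⟧ ≡ 2 → Φ × Ψ
both (yes x) (yes y) _ = x , y
both (yes _) (no _)  ()
both (no _)  (yes _) ()
both (no _)  (no _)  ()

module _ {A : Set} where

  total : (A → ℕ) → List A → ℕ
  total f xs = sum (map f xs)

  data Suffixes (T : A → List A → Set) : List A → Set where
    []  : Suffixes T []
    _∷_ : ∀ {x xs} → T x xs → Suffixes T xs → Suffixes T (x ∷ xs)

  suffixes : ∀ {T : A → List A → Set} xs → (∀ zs {x us} → xs ≡ zs ++ x ∷ us → T x us) → Suffixes T xs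
  suffixes []       f = []
  suffixes (x ∷ xs) f = f [] refl ∷ suffixes xs (λ zs eq → f (x ∷ zs) (cong (x ∷_) eq))

  total-cong : ∀ {f g : A → ℕ} → (∀ x → f x ≡ g x) → ∀ xs → total f xs ≡ total g xs
  total-cong f≗g xs = cong sum (map-cong f≗g xs)

  total-++ : ∀ (f : A → ℕ) xs ys → total f (xs ++ ys) ≡ total f xs + total f ys
  total-++ f xs ys = trans (cong sum (map-++ f xs ys)) (sum-++ (map f xs) (map f ys))

  total-++₄ : ∀ (f : A → ℕ) ws xs ys zs →
    total f (ws ++ xs ++ ys ++ zs) ≡ total f ws + (total f xs + (total f ys + total f zs))
  total-++₄ f ws xs ys zs rewrite total-++ f ws (xs ++ ys ++ zs) | total-++ f xs (ys ++ zs) | total-++ f ys zs = refl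

  length-++₄ : ∀ (ws xs ys zs : List A) →
    length (ws ++ xs ++ ys ++ zs) ≡ length ws + (length xs + (length ys + length zs))
  length-++₄ ws xs ys zs rewrite length-++ ws {xs ++ ys ++ zs} | length-++ xs {ys ++ zs} | length-++ ys {zs} = refl

  total-↭ : ∀ (f : A → ℕ) {xs ys} → xs ↭ ys → total f xs ≡ total f ys
  total-↭ f σ = sum-↭ (Perm.map⁺ f σ)

  total-+ : ∀ (f g : A → ℕ) xs → total (λ x → f x + g x) xs ≡ total f xs + total g xs
  total-+ f g []       = refl
  total-+ f g (x ∷ xs) = trans (cong (f x + g x +_) (total-+ f g xs)) (lemma (f x) (g x) (total f xs) (total g xs))
    where
    lemma : ∀ a b c d → a + b + (c + d) ≡ a + c + (b + d)
    lemma = solve-∀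

  total-+₄ : ∀ (f g h k : A → ℕ) xs →
    total (λ x → f x + g x + h x + k x) xs ≡ total f xs + (total g xs + (total h xs + (total k xs + 0)))
  total-+₄ f g h k xs = trans (total-+ (λ x → f x + g x + h x) k xs)
    (trans (cong (_+ total k xs) (trans (total-+ (λ x → f x + g x) h xs) (cong (_+ total h xs) (total-+ f g xs))))
      (lemma (total f xs) (total g xs) (total h xs) (total k xs)))
    where
    lemma : ∀ a b c d → a + b + c + d ≡ a + (b + (c + (d + 0)))
    lemma = solve-∀

sum₄ : ∀ {a b c d k₁ k₂ k₃ k₄} → a ≡ k₁ → b ≡ k₂ → c ≡ k₃ → d ≡ k₄ →
       a + (b + (c + (d + 0))) ≡ k₁ + (k₂ + (k₃ + (k₄ + 0)))
sum₄ refl refl refl refl = refl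

positive : ℕ → ℕ
positive zero    = 0
positive (suc _) = 1

-- On a leg, b counts its own leaf and a the other ones. Charge to x the value b x, the second unit of a x, and
-- the first unit of a at the successor of x. Then x is overcharged only if a x = 2 and b x = 1, which is
-- compensated by β = 0.
module OwnLeg {A : Set} (a b : A → ℕ) (β : ℕ) (β≤1 : β ≤ 1) where

  Charge : A → List A → Set
  Charge x []       = a x ≡ 0 × b x ≡ 0
  Charge x (y ∷ ys) = (1 ≤ a y → b x ≡ 0 × a x ≤ 1) × a x ≤ 2 × b x ≤ 1 ×
                      (a x ≡ 2 → b x ≡ 1 → β ≡ 0 × All (λ z → a z ≡ 0) (y ∷ ys))

  w : A → ℕ
  w x = a x + b x

  only-b : ∀ {x xs} → Suffixes Charge (x ∷ xs) → All (λ z → a z ≡ 0) (x ∷ xs) → total w (x ∷ xs) ≤ length xs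
  only-b ((p , q) ∷ []) _ rewrite p | q = z≤n
  only-b {x} ((_ , _ , b≤1 , _) ∷ s@(_ ∷ _)) (p ∷ ps) rewrite p = ℕ.+-mono-≤ b≤1 (only-b s ps)

  -- One step of the induction in `charged`: `α` and `α′` stand for `a` at a vertex and at its
  -- successor, `γ` for `b` at the former.
  bound : ∀ α {γ} α′ → α ≤ 2 → γ ≤ 1 → (1 ≤ α′ → γ ≡ 0 × α ≤ 1) → ¬ (α ≡ 2 × γ ≡ 1) →
          α + γ + positive α′ ≤ 1 + positive α
  bound 0 zero    _ γ≤1 _     _ = subst (_≤ 1) (sym (ℕ.+-identityʳ _)) γ≤1
  bound 0 (suc _) _ _   light _ rewrite proj₁ (light (s≤s z≤n)) = s≤s z≤n
  bound 1 zero    _ γ≤1 _     _ = s≤s (subst (_≤ 1) (sym (ℕ.+-identityʳ _)) γ≤1)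
  bound 1 (suc _) _ _   light _ rewrite proj₁ (light (s≤s z≤n)) = s≤s (s≤s z≤n)
  bound 2 {0} zero _ _ _ _ = ℕ.≤-refl
  bound 2 {1} zero _ _ _ ¬d = ⊥-elim (¬d (refl , refl))
  bound 2 {suc (suc _)} zero _ (s≤s ()) _ _
  bound 2 (suc _) _ _   light _ with s≤s () ← proj₂ (light (s≤s z≤n))
  bound (suc (suc (suc _))) _ (s≤s (s≤s ())) _ _ _

  heavy : ∀ {α γ t δ} k → α ≡ 2 → γ ≡ 1 → δ ≡ 0 → t ≤ k → α + γ + t + δ ≤ suc (suc k) + positive α
  heavy {t = t} k refl refl refl t≤k rewrite ℕ.+-identityʳ t =
    ℕ.≤-trans (ℕ.+-monoʳ-≤ 3 t≤k) (ℕ.≤-reflexive (ℕ.+-comm 1 (2 + k)))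

  -- The first unit of `a x` is charged to the vertex before `x`, hence `positive (a x)` on the
  -- right. At the last vertex `a` and `b` are zero, so its unit is free to pay for `β` or for the
  -- overcharged vertex.
  charged : ∀ {x xs} → Suffixes Charge (x ∷ xs) → total w (x ∷ xs) + β ≤ suc (length xs) + positive (a x)
  charged ((p , q) ∷ []) rewrite p | q = ℕ.≤-trans β≤1 (ℕ.m≤m+n 1 0)
  charged {x} {y ∷ ys} ((light , a≤2 , b≤1 , double) ∷ s@(_ ∷ _)) with (a x ≟ 2) ×-dec (b x ≟ 1)
  -- After an overcharged vertex `a` vanishes, so `only-b` takes the place of the induction
  -- hypothesis.
  ... | yes (p , q) = heavy (length ys) p q (proj₁ (double p q)) (only-b s (proj₂ (double p q)))
  ... | no ¬pq = begin
    a x + b x + total w (y ∷ ys) + β                    ≡⟨ ℕ.+-assoc (a x + b x) _ β ⟩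
    a x + b x + (total w (y ∷ ys) + β)                  ≤⟨ ℕ.+-monoʳ-≤ (a x + b x) (charged s) ⟩
    a x + b x + (suc (length ys) + positive (a y))      ≡⟨ lemma (a x + b x) (length ys) _ ⟩
    suc (length ys) + (a x + b x + positive (a y))
      ≤⟨ ℕ.+-monoʳ-≤ (suc (length ys)) (bound (a x) (a y) a≤2 b≤1 light ¬pq) ⟩
    suc (length ys) + (1 + positive (a x))              ≡⟨ lemma′ (length ys) _ ⟩
    suc (suc (length ys)) + positive (a x)              ∎
    where
    open ℕ.≤-Reasoning
    lemma : ∀ t k p → t + (suc k + p) ≡ suc k + (t + p)
    lemma = solve-∀
    lemma′ : ∀ k p → suc k + (1 + p) ≡ suc (suc k) + p
    lemma′ = solve-∀

-- In the two-hub case `xs` is a leg and `x` its hub. The edge from a vertex to the next pays for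
-- `b` at the former and for `a` at the latter, so the number of edges, `length xs`, bounds the
-- total.
module Staggered {A : Set} (a b : A → ℕ) where

  Edge : A → List A → Set
  Edge x []      = b x ≡ 0
  Edge x (y ∷ _) = a y + b x ≤ 1

  staggered : ∀ {x xs} → Suffixes Edge (x ∷ xs) → total (λ z → a z + b z) xs + b x ≤ length xs
  staggered (p ∷ []) rewrite p = z≤n
  staggered {x} {y ∷ ys} (p ∷ s@(_ ∷ _)) =
    ℕ.≤-trans (ℕ.≤-reflexive (lemma (a y) (b y) _ (b x))) (ℕ.+-mono-≤ p (staggered s))
    where
    lemma : ∀ a b t b′ → a + b + t + b′ ≡ (a + b′) + (t + b)
    lemma = solve-∀

-- l and r count the adjacent leaves on either side. A vertex with l = 2 is paid for by the vertex before it
-- and one with r = 2 by the vertex after it, which are adjacent to no leaf; nothing pays on both sides.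
module Gaps {A : Set} (l r : A → ℕ) (l≤2 : ∀ x → l x ≤ 2) (r≤2 : ∀ x → r x ≤ 2) where

  Unlit : List A → Set
  Unlit []      = ⊤
  Unlit (x ∷ _) = l x ≡ 0

  Gap : A → List A → Set
  Gap x []       = r x ≡ 0
  Gap x (y ∷ ys) = (l x ≡ 0 ⊎ r x ≡ 0) × (l y ≡ 2 → l x ≡ 0 × r x ≡ 0) × (r x ≡ 2 → l y ≡ 0 × r y ≡ 0 × Unlit ys)

  -- e is the amount that x still has to pay for the vertex before it.
  Debt : ℕ → A → List A → Set
  Debt e x xs = e ≡ 0 ⊎ (e ≡ 1 × l x ≡ 0 × r x ≡ 0 × Unlit xs)

  debt : ∀ {y ys} ρ → ρ ≤ 2 → (ρ ≡ 2 → l y ≡ 0 × r y ≡ 0 × Unlit ys) → Debt (ρ ∸ 1) y ys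
  debt 0 _ _ = inj₁ refl
  debt 1 _ _ = inj₁ refl
  debt 2 _ f = inj₂ (refl , f refl)
  debt (suc (suc (suc _))) (s≤s (s≤s ())) _

  -- Balance at one vertex, which has one unit of its own: it pays `e` for the vertex before it and
  -- `λʸ ∸ 1` for the one after it, and receives `λₓ ∸ 1` and `ρ ∸ 1` from them.
  settle : ∀ e λₓ ρ λʸ → λₓ ≤ 2 → ρ ≤ 2 → λʸ ≤ 2 → λₓ ≡ 0 ⊎ ρ ≡ 0 → (λʸ ≡ 2 → λₓ ≡ 0 × ρ ≡ 0) →
           e ≡ 0 ⊎ (e ≡ 1 × λₓ ≡ 0 × ρ ≡ 0 × λʸ ≡ 0) → (λₓ + ρ + e) + (λʸ ∸ 1) ≤ (1 + (λₓ ∸ 1)) + (ρ ∸ 1)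
  settle _ _ _ _ _ _ _ _ _ (inj₂ (refl , refl , refl , refl)) = ℕ.≤-refl
  settle _ _ _ 2 _ _ _ _ f (inj₁ refl) with refl , refl ← f refl = ℕ.≤-refl
  settle _ _ _ (suc (suc (suc _))) _ _ (s≤s (s≤s ())) _ _ _
  settle _ 0 0 0 _ _ _ _ _ (inj₁ refl) = z≤n
  settle _ 0 1 0 _ _ _ _ _ (inj₁ refl) = ℕ.≤-refl
  settle _ 0 2 0 _ _ _ _ _ (inj₁ refl) = ℕ.≤-refl
  settle _ 0 0 1 _ _ _ _ _ (inj₁ refl) = z≤n
  settle _ 0 1 1 _ _ _ _ _ (inj₁ refl) = ℕ.≤-refl
  settle _ 0 2 1 _ _ _ _ _ (inj₁ refl) = ℕ.≤-refl
  settle _ _ (suc (suc (suc _))) _ _ (s≤s (s≤s ())) _ _ _ _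
  settle _ 1 0 0 _ _ _ _ _ (inj₁ refl) = ℕ.≤-refl
  settle _ 2 0 0 _ _ _ _ _ (inj₁ refl) = ℕ.≤-refl
  settle _ 1 0 1 _ _ _ _ _ (inj₁ refl) = ℕ.≤-refl
  settle _ 2 0 1 _ _ _ _ _ (inj₁ refl) = ℕ.≤-refl
  settle _ (suc (suc (suc _))) _ _ (s≤s (s≤s ())) _ _ _ _ _
  settle _ (suc _) (suc _) _ _ _ _ (inj₁ ()) _ _
  settle _ (suc _) (suc _) _ _ _ _ (inj₂ ()) _ _

  lit : A → ℕ
  lit x = l x + r x

  -- The amount `l x ∸ 1` on the right is supplied by the vertex before `x`. At the first vertex of
  -- the trunk it will vanish.
  gaps : ∀ {x xs e} → Suffixes Gap (x ∷ xs) → Debt e x xs →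
         total lit (x ∷ xs) + e ≤ suc (length xs) + (l x ∸ 1)
  gaps {x} (p ∷ []) (inj₁ refl) rewrite p with l x | l≤2 x
  ... | 0 | _ = z≤n
  ... | 1 | _ = ℕ.≤-refl
  ... | 2 | _ = ℕ.≤-refl
  ... | suc (suc (suc _)) | s≤s (s≤s ())
  gaps (p ∷ []) (inj₂ (refl , q , _)) rewrite p | q = ℕ.≤-refl
  -- The surplus `r x ∸ 1` is added on both sides and handed to `y` as its debt.
  gaps {x} {y ∷ ys} {e} ((one-sided , before , after) ∷ s@(_ ∷ _)) d = ℕ.+-cancelʳ-≤ (r x ∸ 1) _ _ (begin
    l x + r x + total lit (y ∷ ys) + e + (r x ∸ 1)             ≡⟨ lemma (l x + r x) (total lit (y ∷ ys)) e (r x ∸ 1) ⟩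
    (total lit (y ∷ ys) + (r x ∸ 1)) + (l x + r x + e)
      ≤⟨ ℕ.+-monoˡ-≤ (l x + r x + e) (gaps s (debt (r x) (r≤2 x) after)) ⟩
    (suc (length ys) + (l y ∸ 1)) + (l x + r x + e)          ≡⟨ lemma′ (length ys) (l y ∸ 1) (l x + r x + e) ⟩
    suc (length ys) + ((l x + r x + e) + (l y ∸ 1))
      ≤⟨ ℕ.+-monoʳ-≤ (suc (length ys)) (settle e (l x) (r x) (l y) (l≤2 x) (r≤2 x) (l≤2 y) one-sided before d) ⟩
    suc (length ys) + ((1 + (l x ∸ 1)) + (r x ∸ 1))          ≡⟨ lemma″ (length ys) (l x ∸ 1) (r x ∸ 1) ⟩
    suc (suc (length ys)) + (l x ∸ 1) + (r x ∸ 1)            ∎)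
    where
    open ℕ.≤-Reasoning
    lemma : ∀ a t e b → a + t + e + b ≡ (t + b) + (a + e)
    lemma = solve-∀
    lemma′ : ∀ k a b → (suc k + a) + b ≡ suc k + (b + a)
    lemma′ = solve-∀
    lemma″ : ∀ k a b → suc k + ((1 + a) + b) ≡ suc (suc k) + a + b
    lemma″ = solve-∀

-- Duplicate-free lists and degree sums

module _ {A : Set} where

  private
    variable
      xs ys : List A

  Unique-resp-↭ : xs ↭ ys → Unique xs → Unique ys
  Unique-resp-↭ σ = PermS.Unique-resp-↭ (setoid A) (↭⇒↭ₛ σ)

  lookup-injective : ∀ {xs : List A} → Unique xs → ∀ i j → lookup xs i ≡ lookup xs j → i ≡ j
  lookup-injective (_ ∷ _)  zero    zero    _  = refl
  lookup-injective (p ∷ _)  zero    (suc j) eq = ⊥-elim (All.lookup p (∈-lookup j) eq)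
  lookup-injective (p ∷ _)  (suc i) zero    eq = ⊥-elim (All.lookup p (∈-lookup i) (sym eq))
  lookup-injective (_ ∷ ps) (suc i) (suc j) eq = cong suc (lookup-injective ps i j eq)

  Unique-++⁻ˡ : ∀ (xs : List A) {ys} → Unique (xs ++ ys) → Unique xs
  Unique-++⁻ˡ []       _        = []
  Unique-++⁻ˡ (x ∷ xs) (p ∷ ps) = All.tabulate (λ y∈ → All.lookup p (∈-++⁺ˡ y∈)) ∷ Unique-++⁻ˡ xs ps

  Unique-++⁻ʳ : ∀ (l : List A) {l′} → Unique (l ++ l′) → Unique l′
  Unique-++⁻ʳ []      un       = un
  Unique-++⁻ʳ (_ ∷ l) (_ ∷ un) = Unique-++⁻ʳ l un

  Unique-disjoint : ∀ (l : List A) {l′} → Unique (l ++ l′) → ∀ {v} → v ∈ l → v ∉ l′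
  Unique-disjoint (_ ∷ l) (x∉ ∷ _)  (here refl) v∈ = All.lookup x∉ (∈-++⁺ʳ l v∈) refl
  Unique-disjoint (_ ∷ l) (_  ∷ un) (there v∈l) v∈ = Unique-disjoint l un v∈l v∈

  -- Sizes and sums over `xs` and `ys` then differ only by the contribution of the leftover `zs`,
  -- which gives the pigeonhole bounds below.
  complement : Unique xs → (∀ {x} → x ∈ xs → x ∈ ys) → ∃[ zs ] xs ++ zs ↭ ys
  complement {[]}     {ys} _        _ = ys , ↭-refl
  complement {x ∷ xs} {ys} (x∉ ∷ u) f with complement u (f ∘ there)
  ... | zs , σ with Perm.∈-resp-↭ (↭-sym σ) (f (here refl))
  ...   | x∈ with ∈-++⁻ xs x∈
  ...     | inj₁ x∈xs = ⊥-elim (All.lookup x∉ x∈xs refl)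
  ...     | inj₂ x∈zs with us , vs , refl ← ∈-∃++ x∈zs =
    us ++ vs , ↭-trans (prep x (++-assoc⁻ xs us vs)) (↭-trans (↭-sym (Perm.shift x (xs ++ us) vs))
                 (↭-trans (Perm.++-assoc xs us (x ∷ vs)) σ))
    where
    ++-assoc⁻ : ∀ as bs cs → as ++ bs ++ cs ↭ (as ++ bs) ++ cs
    ++-assoc⁻ as bs cs = ↭-sym (Perm.++-assoc as bs cs)

  Unique⇒length≤ : Unique xs → (∀ {x} → x ∈ xs → x ∈ ys) → length xs ≤ length ys
  Unique⇒length≤ {xs} u f with complement u f
  ... | zs , σ = subst (length xs ≤_) (trans (sym (length-++ xs)) (Perm.↭-length σ)) (ℕ.m≤m+n _ _)

  Unique⇒↭ : Unique xs → Unique ys → (∀ {x} → x ∈ xs → x ∈ ys) → (∀ {x} → x ∈ ys → x ∈ xs) → xs ↭ ys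
  Unique⇒↭ {xs} {ys} u v f g with complement u f
  ... | []     , σ = ↭-trans (↭-sym (Perm.++-identityʳ xs)) σ
  ... | z ∷ zs , σ = ⊥-elim (ℕ.<-irrefl refl (ℕ.≤-trans bigger (Unique⇒length≤ v g)))
    where
    bigger : length xs < length ys
    bigger = subst (length xs <_) (trans (sym (length-++ xs)) (Perm.↭-length σ)) (ℕ.m<m+n _ (s≤s z≤n))

  AllPairs-lookup : ∀ {R : A → A → Set} {x y} → AllPairs R xs → x ∈ xs → y ∈ xs → x ≡ y ⊎ R x y ⊎ R y x
  AllPairs-lookup (_ ∷ _)  (here refl) (here refl) = inj₁ refl
  AllPairs-lookup (p ∷ _)  (here refl) (there y∈)  = inj₂ (inj₁ (All.lookup p y∈))
  AllPairs-lookup (p ∷ _)  (there x∈)  (here refl) = inj₂ (inj₂ (All.lookup p x∈))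
  AllPairs-lookup (_ ∷ ps) (there x∈)  (there y∈)  = AllPairs-lookup ps x∈ y∈

  -- Passage from the subsets of the definitions to lists, on which all counting takes place.
  ∣tabulate∣ : ∀ {m} {P : A → Set} (P? : Decidable P) (f : Fin m → A) →
    ∣ Vec.tabulate (λ i → does (P? (f i))) ∣ ≡ length (filter P? (List.tabulate f))
  ∣tabulate∣ {zero}  P? f = refl
  ∣tabulate∣ {suc m} P? f with P? (f Fin.zero)
  ... | yes _ = cong suc (∣tabulate∣ P? (f ∘ Fin.suc))
  ... | no _  = ∣tabulate∣ P? (f ∘ Fin.suc)

  length-filter≡total : ∀ {P : A → Set} (P? : Decidable P) xs → length (filter P? xs) ≡ total (λ x → ⟦ P? x ⟧) xs
  length-filter≡total P? []       = refl
  length-filter≡total P? (x ∷ xs) with P? x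
  ... | yes _ = cong suc (length-filter≡total P? xs)
  ... | no _  = length-filter≡total P? xs

module _ {n : ℕ} where

  private
    variable
      P : Fin n → Set

  ∈-tabulate⁺ : (P? : Decidable P) {v : Fin n} → P v → v ∈ˢ Vec.tabulate (λ w → does (P? w))
  ∈-tabulate⁺ P? {v} p = Vec.lookup⇒[]= v _ (trans (Vec.lookup∘tabulate _ v) (dec-true (P? v) p))

  ∈-tabulate⁻ : (P? : Decidable P) {v : Fin n} → v ∈ˢ Vec.tabulate (λ w → does (P? w)) → P v
  ∈-tabulate⁻ P? {v} v∈ with P? v | trans (sym (Vec.lookup∘tabulate (λ w → does (P? w)) v)) (Vec.[]=⇒lookup v∈)
  ... | yes p | _ = p

  Unique⇒length≤n : {xs : List (Fin n)} → Unique xs → length xs ≤ n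
  Unique⇒length≤n {xs} u = subst (length xs ≤_) (length-tabulate {n = n} (λ i → i))
    (Unique⇒length≤ u (λ {x} _ → ∈-allFin x))

  module _ (P? : Decidable P) where

    private
      members : List (Fin n)
      members = filter P? (allFin n)

      members-unique : Unique members
      members-unique = Unique.filter⁺ P? (Unique.allFin⁺ n)

    -- With adjacency to a leaf as `P`, this bounds the degree of the leaf by a sum over a tree
    -- containing all its neighbours.
    ∣tabulate∣≤total : ∀ {V} → (∀ {v} → P v → v ∈ V) → ∣ Vec.tabulate (λ v → does (P? v)) ∣ ≤ total (λ v → ⟦ P? v ⟧) V
    ∣tabulate∣≤total {V} f
      with zs , σ ← complement {xs = members} {V} members-unique
                      (λ v∈ → f (proj₂ (∈-filter⁻ P? {xs = allFin n} v∈))) = begin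
      ∣ Vec.tabulate (λ v → does (P? v)) ∣        ≡⟨ ∣tabulate∣ P? (λ v → v) ⟩
      length members                              ≡⟨ cong length (filter-all P? (all-filter P? (allFin n))) ⟨
      length (filter P? members)                  ≡⟨ length-filter≡total P? members ⟩
      total (λ v → ⟦ P? v ⟧) members              ≤⟨ ℕ.m≤m+n _ _ ⟩
      total (λ v → ⟦ P? v ⟧) members + total _ zs ≡⟨ total-++ _ members zs ⟨
      total (λ v → ⟦ P? v ⟧) (members ++ zs)      ≡⟨ total-↭ _ σ ⟩
      total (λ v → ⟦ P? v ⟧) V                    ∎
      where open ℕ.≤-Reasoning

    members-↭ : ∀ {V} → Unique V → (∀ {v} → P v → v ∈ V) → (∀ {v} → v ∈ V → P v) → members ↭ V
    members-↭ u f g = Unique⇒↭ members-unique u (λ v∈ → f (proj₂ (∈-filter⁻ P? {xs = allFin n} v∈)))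
                        (λ v∈ → ∈-filter⁺ P? (∈-allFin _) (g v∈))

∈-subsets : ∀ {n} (X : Subset n) → X ∈ subsets n
∈-subsets Vec.[]            = here refl
∈-subsets (inside Vec.∷ X)  = ∈-cartesianProductWith⁺ Vec._∷_ {xs = inside ∷ outside ∷ []} (here refl) (∈-subsets X)
∈-subsets (outside Vec.∷ X) =
  ∈-cartesianProductWith⁺ Vec._∷_ {xs = inside ∷ outside ∷ []} (there (here refl)) (∈-subsets X)

module _ {n : ℕ} (G : Graph n) where

  -- The vertices of `ys` form a subset `X` that occurs in the enumeration defining `σ`, and a
  -- minimum is at most each of its entries.
  σ-lower-bound : ∀ {d ys} → [ d ] ≤⁺ σ (length ys) G → Unique ys → AllPairs (λ x y → ¬ Adj G x y) ys →
                  d ≤ total (degree G) ys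
  σ-lower-bound {d} {ys} h u a = subst (d ≤_) (total-↭ (degree G) members↭)
    (Supremum.[≤]-injective _≤_ (TotalOrder.trans ℕ⁺-totalOrder h
      (All.lookup (Extrema.min≤xs ℕ⁺-totalOrder ⊤⁺ sums) (∈-map⁺ (λ X → [ degreeSum G X ]) X∈))))
    where
    _∈ys? : Decidable (_∈ ys)
    v ∈ys? = DecMembership._∈?_ Fin._≟_ v ys
    X = Vec.tabulate (λ v → does (v ∈ys?))
    sums = map (λ X → [ degreeSum G X ]) (independentSets G (length ys))
    members↭ : filter (_∈ˢ? X) (allFin n) ↭ ys
    members↭ = members-↭ (_∈ˢ? X) u (∈-tabulate⁻ _∈ys?) (∈-tabulate⁺ _∈ys?)
    independent : Independent G X
    independent v w v∈ w∈ e with AllPairs-lookup a (∈-tabulate⁻ _∈ys? v∈) (∈-tabulate⁻ _∈ys? w∈)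
    ... | inj₁ eq        = Graph.irrefl G eq e
    ... | inj₂ (inj₁ ¬e) = ¬e e
    ... | inj₂ (inj₂ ¬e) = ¬e (Graph.sym G e)
    ∣X∣ : ∣ X ∣ ≡ length ys
    ∣X∣ = trans (∣tabulate∣ _∈ys? (λ v → v)) (Perm.↭-length (members-↭ _∈ys? u (λ v∈ → v∈) (λ v∈ → v∈)))
    X∈ : X ∈ independentSets G (length ys)
    X∈ = ∈-filter⁺ (λ X → independent? G X ×-dec (∣ X ∣ ≟ length ys)) (∈-subsets X) (independent , ∣X∣)

-- Paths and spiders

module Paths {n : ℕ} (G : Graph n) where

  private
    variable
      a b c d x y : Fin n
      xs ys zs : List (Fin n)

  infix 4 _~_
  _~_ : Fin n → Fin n → Set
  _~_ = Adj G

  ~-sym : a ~ b → b ~ a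
  ~-sym = Graph.sym G

  infixr 5 _∷_
  -- Repetitions are not excluded here. In the application the vertex lists of all parts of a tree
  -- together are a permutation of a duplicate-free list.
  data Path : Fin n → List (Fin n) → Fin n → Set where
    [-] : Path a (a ∷ []) a
    _∷_ : a ~ b → Path b xs c → Path a (a ∷ xs) c

  -- Recording the vertices only up to order makes reversing a path invisible in its type.
  infix 4 _⟨_⟩_
  _⟨_⟩_ : Fin n → List (Fin n) → Fin n → Set
  a ⟨ xs ⟩ b = ∃[ ys ] Path a ys b × ys ↭ xs

  exact : Path a xs b → a ⟨ xs ⟩ b
  exact p = _ , p , ↭-refl

  point : a ⟨ a ∷ [] ⟩ a
  point = exact [-]

  reorder : xs ↭ ys → a ⟨ xs ⟩ b → a ⟨ ys ⟩ b
  reorder σ (l , p , τ) = l , p , ↭-trans τ σ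

  Path-++ : Path a xs b → b ~ c → Path c ys d → Path a (xs ++ ys) d
  Path-++ [-]     e q = e ∷ q
  Path-++ (f ∷ p) e q = f ∷ Path-++ p e q

  infixr 5 _⁀⟨_⟩_
  _⁀⟨_⟩_ : a ⟨ xs ⟩ b → b ~ c → c ⟨ ys ⟩ d → a ⟨ xs ++ ys ⟩ d
  (_ , p , σ) ⁀⟨ e ⟩ (_ , q , τ) = _ , Path-++ p e q , Perm.++⁺ σ τ

  reverse : a ⟨ xs ⟩ b → b ⟨ xs ⟩ a
  reverse (_ , p , σ) = reorder σ (go p)
    where
    go : Path a xs b → b ⟨ xs ⟩ a
    go [-]                    = point
    go (_∷_ {a} {xs = xs} e p) = reorder (↭-sym (Perm.∷↭∷ʳ a xs)) (go p ⁀⟨ ~-sym e ⟩ point)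

  uncons : a ⟨ a ∷ xs ⟩ b → (xs ≡ [] × a ≡ b) ⊎ (∃[ q ] a ~ q × q ⟨ xs ⟩ b)
  uncons (_ , [-]   , σ) = inj₁ (Perm.↭-empty-inv (↭-sym (Perm.drop-∷ σ)) , refl)
  uncons (_ , e ∷ p , σ) = inj₂ (_ , e , _ , p , Perm.drop-∷ σ)

  -- Both legs at a hub become one path, with the hub as an ordinary vertex on it; this is how
  -- rerouted trees dispose of a hub.
  bend : c ⟨ c ∷ xs ⟩ x → c ⟨ c ∷ ys ⟩ y → x ⟨ c ∷ xs ++ ys ⟩ y
  bend {xs = xs} p q with uncons q
  ... | inj₁ (refl , refl)  = reorder (prep _ (↭-sym (Perm.++-identityʳ xs))) (reverse p)
  ... | inj₂ (_ , e , q′) = reverse p ⁀⟨ e ⟩ q′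

  split : ∀ zs {us} → Path c (c ∷ zs ++ a ∷ us) b →
          ∃[ w ] Path c (c ∷ zs) w × w ~ a × Path a (a ∷ us) b
  split zs p = go zs p refl
    where
    go : ∀ zs {us} → Path c xs b → xs ≡ c ∷ zs ++ a ∷ us →
         ∃[ w ] Path c (c ∷ zs) w × w ~ a × Path a (a ∷ us) b
    go []       (e ∷ [-])     refl = _ , [-] , e , [-]
    go []       (e ∷ f ∷ p)   refl = _ , [-] , e , f ∷ p
    go (z ∷ []) (_ ∷ [-])     ()
    go (z ∷ _ ∷ _) (_ ∷ [-])  ()
    go (z ∷ zs) (e ∷ f ∷ p)   refl with go zs (f ∷ p) refl
    ... | w , q , g , r = w , e ∷ q , g , r

  last-out : Path a xs b → ∃[ ys ] b ∷ ys ↭ xs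
  last-out p with reverse (exact p)
  ... | _ , [-]   , σ = _ , σ
  ... | _ , _ ∷ _ , σ = _ , σ

module Legs {n : ℕ} (G : Graph n) where
  open Paths G
  -- Up to permutation, concatenation is commutative, so that a rerouted tree has the same vertices
  -- as the old one is an identity for the solver.
  open Algebra.Solver.CommutativeMonoid (Perm.++-commutativeMonoid {A = Fin n}) public
    using (solve; _⊕_; _⊜_; id)

  private
    variable
      c u x y : Fin n
      l₁ l₂ l₃ l₄ U xs : List (Fin n)

  -- The centre is kept out of `body`, so that several legs can share it, and a `body` is never
  -- empty. Spiders with an empty leg are dealt with separately.
  record Leg (c : Fin n) : Set where
    constructor leg
    field
      {body}      : List (Fin n)
      {foot leaf} : Fin n
      edge        : c ~ foot
      path        : Path foot body leaf

    inner : foot ⟨ body ⟩ leaf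
    inner = exact path

    full : c ⟨ c ∷ body ⟩ leaf
    full = exact (edge ∷ path)

  open Leg public

  -- A record instead of a bare permutation, because the four lists could not be inferred from their
  -- concatenation.
  record Spans (U : List (Fin n)) (c : Fin n) (l₁ l₂ l₃ l₄ : List (Fin n)) : Set where
    constructor spans
    field arrangement : c ∷ l₁ ++ l₂ ++ l₃ ++ l₄ ↭ U

  open Spans public

  χ : Fin n → Fin n → ℕ
  χ x u = ⟦ adj? G x u ⟧

  swap₁₂ : Spans U c l₁ l₂ l₃ l₄ → Spans U c l₂ l₁ l₃ l₄
  swap₁₂ {c = c} {l₁} {l₂} {l₃} {l₄} (spans σ) = spans (↭-trans (solve 5
    (λ c l₁ l₂ l₃ l₄ → (c ⊕ l₂ ⊕ l₁ ⊕ l₃ ⊕ l₄) ⊜ (c ⊕ l₁ ⊕ l₂ ⊕ l₃ ⊕ l₄)) ↭-refl (c ∷ []) l₁ l₂ l₃ l₄) σ)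

  swap₂₃ : Spans U c l₁ l₂ l₃ l₄ → Spans U c l₁ l₃ l₂ l₄
  swap₂₃ {c = c} {l₁} {l₂} {l₃} {l₄} (spans σ) = spans (↭-trans (solve 5
    (λ c l₁ l₂ l₃ l₄ → (c ⊕ l₁ ⊕ l₃ ⊕ l₂ ⊕ l₄) ⊜ (c ⊕ l₁ ⊕ l₂ ⊕ l₃ ⊕ l₄)) ↭-refl (c ∷ []) l₁ l₂ l₃ l₄) σ)

  swap₃₄ : Spans U c l₁ l₂ l₃ l₄ → Spans U c l₁ l₂ l₄ l₃
  swap₃₄ {c = c} {l₁} {l₂} {l₃} {l₄} (spans σ) = spans (↭-trans (solve 5
    (λ c l₁ l₂ l₃ l₄ → (c ⊕ l₁ ⊕ l₂ ⊕ l₄ ⊕ l₃) ⊜ (c ⊕ l₁ ⊕ l₂ ⊕ l₃ ⊕ l₄)) ↭-refl (c ∷ []) l₁ l₂ l₃ l₄) σ)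

  shift-cut : ∀ zs {us} → Spans U c (zs ++ u ∷ us) l₂ l₃ l₄ → Spans U c ((zs ++ u ∷ []) ++ us) l₂ l₃ l₄
  shift-cut zs {us} = subst (λ l → Spans _ _ l _ _ _) (sym (++-assoc zs (_ ∷ []) us))

  step : Path u (u ∷ y ∷ xs) x → u ~ y × Path y (y ∷ xs) x
  step (e ∷ [-])   = e , [-]
  step (e ∷ f ∷ p) = e , f ∷ p

  no-empty-path : ¬ Path u [] x
  no-empty-path ()

  prefix-leg : ∀ zs → Path c (c ∷ zs) u → u ~ x → ∃[ f ] c ~ f × Path f (zs ++ x ∷ []) x
  prefix-leg []       [-] e = _ , e , [-]
  prefix-leg (_ ∷ _)  p   e = let g , q = step p in _ , g , Path-++ q e [-]

  first-out : (L : Leg c) → ∃[ ys ] foot L ∷ ys ↭ body L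
  first-out (leg _ [-])     = [] , ↭-refl
  first-out (leg _ (_ ∷ _)) = _ , ↭-refl

  last-out-tail : Path u (u ∷ xs) x → xs ≡ [] ⊎ (∃[ ys ] x ∷ ys ↭ xs)
  last-out-tail [-]     = inj₁ refl
  last-out-tail (_ ∷ p) = inj₂ (last-out p)

  -- The edge from `x` to `c` closes the path to a cycle, which can be opened just before `u`; a
  -- path with one vertex needs no such edge.
  rotate : Path c (c ∷ xs) x → xs ≡ [] ⊎ x ~ c → ∀ zs {us} → c ∷ xs ≡ zs ++ u ∷ us → ∃[ y ] u ⟨ c ∷ xs ⟩ y
  rotate p _           []           refl = _ , exact p
  rotate p (inj₁ refl) (_ ∷ [])     ()
  rotate p (inj₁ refl) (_ ∷ _ ∷ _)  ()
  rotate {u = u} p (inj₂ e) (z ∷ zs) {us} refl with split zs p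
  ... | _ , q , _ , r = _ , reorder (Perm.++-comm (u ∷ us) (z ∷ zs)) (exact r ⁀⟨ e ⟩ exact q)

-- Counting the neighbours of the leaves of a maximal spider

module MaximalSpider {n : ℕ} (G : Graph n) (V : List (Fin n)) where
  open Paths G
  open Legs G

  module _
    (no-tripod : ∀ {c l₁ l₂ l₃ x₁ x₂ x₃} → c ⟨ c ∷ l₁ ⟩ x₁ → c ⟨ c ∷ l₂ ⟩ x₂ → c ⟨ c ∷ l₃ ⟩ x₃ →
                 ¬ (c ∷ l₁ ++ l₂ ++ l₃ ↭ V))
    -- The permutation encodes that `y₁`, ..., `y₅` are distinct, since `V` is duplicate-free in the
    -- application.
    (no-star : ∀ {u y₁ y₂ y₃ y₄ y₅ l} → y₁ ∷ y₂ ∷ y₃ ∷ y₄ ∷ y₅ ∷ l ↭ V →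
               All (u ~_) (y₁ ∷ y₂ ∷ y₃ ∷ y₄ ∷ y₅ ∷ []) →
               ¬ AllPairs (λ x y → ¬ x ~ y) (y₁ ∷ y₂ ∷ y₃ ∷ y₄ ∷ y₅ ∷ []))
    where

    private
      variable
        c u u⁻ u⁺ v w x₁ y : Fin n
        Z C : List (Fin n)

    -- The edge would merge two legs into one.
    leaves-nonadjacent : (L₁ L₂ L₃ L₄ : Leg c) →
      Spans V c (body L₁) (body L₂) (body L₃) (body L₄) → ¬ leaf L₁ ~ leaf L₂
    leaves-nonadjacent {c} L₁ L₂ L₃ L₄ σ e =
      no-tripod (full L₁ ⁀⟨ e ⟩ reverse (inner L₂)) (full L₃) (full L₄)
        (↭-trans (solve 5 (λ c l₁ l₂ l₃ l₄ →
            (c ⊕ (l₁ ⊕ l₂) ⊕ l₃ ⊕ l₄) ⊜ (c ⊕ l₁ ⊕ l₂ ⊕ l₃ ⊕ l₄)) ↭-refl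
            (c ∷ []) (body L₁) (body L₂) (body L₃) (body L₄)) (arrangement σ))

    -- In what follows the first leg is Z ++ u ∷ C with leaf x₁, and u⁻, u⁺ are the neighbours of u on it.

    -- Otherwise the first two legs merge into one: from `c` along `Z` to `u⁻`, over to `x₁`, back
    -- to `u`, and over to the leaf of `L₂`.
    own-leaf-≁-pred : c ⟨ c ∷ Z ⟩ u⁻ → u ⟨ u ∷ C ⟩ x₁ → (L₂ L₃ L₄ : Leg c) →
      Spans V c (Z ++ u ∷ C) (body L₂) (body L₃) (body L₄) →
      leaf L₂ ~ u → ¬ x₁ ~ u⁻
    own-leaf-≁-pred {c} {Z} {u = u} {C} p r L₂ L₃ L₄ σ e f =
      no-tripod (p ⁀⟨ ~-sym f ⟩ reverse r ⁀⟨ ~-sym e ⟩ reverse (inner L₂)) (full L₃) (full L₄)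
        (↭-trans (solve 6 (λ c z d l₂ l₃ l₄ →
            (c ⊕ (z ⊕ d ⊕ l₂) ⊕ l₃ ⊕ l₄) ⊜ (c ⊕ (z ⊕ d) ⊕ l₂ ⊕ l₃ ⊕ l₄)) ↭-refl
            (c ∷ []) Z (u ∷ C) (body L₂) (body L₃) (body L₄)) (arrangement σ))

    -- Otherwise the first leg can be cut before `u` and its two parts appended to `L₂` and `L₃`.
    other-leaf-≁-pred : c ⟨ c ∷ Z ⟩ u⁻ → u ⟨ u ∷ C ⟩ x₁ → (L₂ L₃ L₄ : Leg c) →
      Spans V c (Z ++ u ∷ C) (body L₂) (body L₃) (body L₄) →
      leaf L₂ ~ u → ¬ leaf L₃ ~ u⁻
    other-leaf-≁-pred {c} {Z} {u = u} {C} p r L₂ L₃ L₄ σ e f =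
      no-tripod (full L₂ ⁀⟨ e ⟩ r) (p ⁀⟨ ~-sym f ⟩ reverse (inner L₃)) (full L₄)
        (↭-trans (solve 6 (λ c z d l₂ l₃ l₄ →
            (c ⊕ (l₂ ⊕ d) ⊕ (z ⊕ l₃) ⊕ l₄) ⊜ (c ⊕ (z ⊕ d) ⊕ l₂ ⊕ l₃ ⊕ l₄)) ↭-refl
            (c ∷ []) Z (u ∷ C) (body L₂) (body L₃) (body L₄)) (arrangement σ))

    -- The whole first leg could be appended to `L₂`.
    other-leaf-≁-foot : u ⟨ u ∷ C ⟩ x₁ → (L₂ L₃ L₄ : Leg c) →
      Spans V c (u ∷ C) (body L₂) (body L₃) (body L₄) → ¬ leaf L₂ ~ u
    other-leaf-≁-foot {u} {C} {c = c} r L₂ L₃ L₄ σ e =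
      no-tripod (full L₂ ⁀⟨ e ⟩ r) (full L₃) (full L₄)
        (↭-trans (solve 5 (λ c d l₂ l₃ l₄ →
            (c ⊕ (l₂ ⊕ d) ⊕ l₃ ⊕ l₄) ⊜ (c ⊕ d ⊕ l₂ ⊕ l₃ ⊕ l₄)) ↭-refl
            (c ∷ []) (u ∷ C) (body L₂) (body L₃) (body L₄)) (arrangement σ))

    -- The first leg could bypass `u`, which would then join `L₂` to `L₃`.
    pred-≁-succ : c ⟨ c ∷ Z ⟩ u⁻ → u⁺ ⟨ C ⟩ x₁ → (L₂ L₃ L₄ : Leg c) →
      Spans V c (Z ++ u ∷ C) (body L₂) (body L₃) (body L₄) →
      leaf L₂ ~ u → leaf L₃ ~ u → ¬ u⁻ ~ u⁺
    pred-≁-succ {c} {Z} {C = C} {u = u} p r L₂ L₃ L₄ σ e f g =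
      no-tripod (p ⁀⟨ g ⟩ r) (full L₂ ⁀⟨ e ⟩ point ⁀⟨ ~-sym f ⟩ reverse (inner L₃)) (full L₄)
        (↭-trans (solve 7 (λ c z u d l₂ l₃ l₄ →
            (c ⊕ (z ⊕ d) ⊕ (l₂ ⊕ u ⊕ l₃) ⊕ l₄) ⊜ (c ⊕ (z ⊕ u ⊕ d) ⊕ l₂ ⊕ l₃ ⊕ l₄)) ↭-refl
            (c ∷ []) Z (u ∷ []) C (body L₂) (body L₃) (body L₄)) (arrangement σ))

    -- The leg L₂ is continued through all of C, which leaves u free to pick up the leg L₃.
    no-continuation : c ⟨ c ∷ Z ⟩ u⁻ → u⁻ ~ u → w ⟨ C ⟩ y → (L₂ L₃ L₄ : Leg c) →
      Spans V c (Z ++ u ∷ C) (body L₂) (body L₃) (body L₄) →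
      leaf L₃ ~ u → ¬ leaf L₂ ~ w
    no-continuation {c} {Z} {u = u} {C = C} p g r L₂ L₃ L₄ σ e f =
      no-tripod (p ⁀⟨ g ⟩ point ⁀⟨ ~-sym e ⟩ reverse (inner L₃)) (full L₂ ⁀⟨ f ⟩ r) (full L₄)
        (↭-trans (solve 7 (λ c z u d l₂ l₃ l₄ →
            (c ⊕ (z ⊕ u ⊕ l₃) ⊕ (l₂ ⊕ d) ⊕ l₄) ⊜ (c ⊕ (z ⊕ u ⊕ d) ⊕ l₂ ⊕ l₃ ⊕ l₄)) ↭-refl
            (c ∷ []) Z (u ∷ []) C (body L₂) (body L₃) (body L₄)) (arrangement σ))

    -- This is `other-leaf-≁-pred` with the cut moved one place, between `u` and `u⁺`.
    other-leaf-≁-succ : (P L₂ L₃ L₄ : Leg c) → leaf P ~ u → Path u⁺ (u⁺ ∷ C) x₁ →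
      Spans V c (body P ++ u ∷ u⁺ ∷ C) (body L₂) (body L₃) (body L₄) →
      leaf L₃ ~ u → ¬ leaf L₂ ~ u⁺
    other-leaf-≁-succ P L₂ L₃ L₄ g r σ e f =
      other-leaf-≁-pred (full P ⁀⟨ g ⟩ point) (exact r) L₂ L₃ L₄ (shift-cut (body P) σ) f e

    -- `P` is the part of the first leg before `u`. Being a leg it is nonempty, so the predecessor
    -- `leaf P` of `u` is a vertex of the leg and not the centre.
    module _ (P L₂ L₃ L₄ : Leg c) (g : leaf P ~ u) (h : u ~ u⁺) (r : Path u⁺ (u⁺ ∷ C) x₁)
             (σ : Spans V c (body P ++ u ∷ u⁺ ∷ C) (body L₂) (body L₃) (body L₄)) where

      private
        p  = full P
        r′ = exact (h ∷ r)

        L₁ : Leg c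
        L₁ = leg (edge P) (Path-++ (path P) g (h ∷ r))

      -- Otherwise `u` is the centre of an induced star with five ends: the three leaves, the
      -- predecessor `leaf P` and the successor `u⁺`.
      not-all-three : leaf L₂ ~ u → leaf L₃ ~ u → ¬ leaf L₄ ~ u
      not-all-three e₂ e₃ e₄ with last-out (path P) | last-out (path L₂) | last-out (path L₃) | last-out (path L₄)
      ... | z , τ | l₂ , τ₂ | l₃ , τ₃ | l₄ , τ₄ = no-star
        (↭-trans (↭-trans (solve 11 (λ c x₂ x₃ x₄ v z u d l₂ l₃ l₄ →
            (x₂ ⊕ x₃ ⊕ x₄ ⊕ v ⊕ d ⊕ c ⊕ u ⊕ z ⊕ l₂ ⊕ l₃ ⊕ l₄)
              ⊜ (c ⊕ ((v ⊕ z) ⊕ u ⊕ d) ⊕ (x₂ ⊕ l₂) ⊕ (x₃ ⊕ l₃) ⊕ (x₄ ⊕ l₄))) ↭-refl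
            (c ∷ []) (leaf L₂ ∷ []) (leaf L₃ ∷ []) (leaf L₄ ∷ []) (leaf P ∷ []) z (u ∷ []) (u⁺ ∷ C) l₂ l₃ l₄)
          (prep c (Perm.++⁺ (Perm.++⁺ τ (↭-refl {x = u ∷ u⁺ ∷ C})) (Perm.++⁺ τ₂ (Perm.++⁺ τ₃ τ₄))))) (arrangement σ))
        (~-sym e₂ ∷ ~-sym e₃ ∷ ~-sym e₄ ∷ ~-sym g ∷ h ∷ [])
        (( leaves-nonadjacent L₂ L₃ L₁ L₄ (swap₂₃ (swap₁₂ σ))
         ∷ leaves-nonadjacent L₂ L₄ L₁ L₃ (swap₂₃ (swap₁₂ (swap₃₄ σ)))
         ∷ other-leaf-≁-pred p r′ L₃ L₂ L₄ (swap₂₃ σ) e₃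
         ∷ other-leaf-≁-succ P L₂ L₃ L₄ g r σ e₃ ∷ [])
        ∷ ( leaves-nonadjacent L₃ L₄ L₁ L₂ (swap₂₃ (swap₁₂ (swap₃₄ (swap₂₃ σ))))
         ∷ other-leaf-≁-pred p r′ L₂ L₃ L₄ σ e₂
         ∷ other-leaf-≁-succ P L₃ L₂ L₄ g r (swap₂₃ σ) e₂ ∷ [])
        ∷ ( other-leaf-≁-pred p r′ L₂ L₄ L₃ (swap₃₄ σ) e₂
         ∷ other-leaf-≁-succ P L₄ L₂ L₃ g r (swap₂₃ (swap₃₄ σ)) e₂ ∷ [])
        ∷ ( pred-≁-succ p (exact r) L₂ L₃ L₄ σ e₂ e₃ ∷ [])
        ∷ [] ∷ [])

      module _ (e₁ : x₁ ~ u) (e₂ : leaf L₂ ~ u) (e₃ : leaf L₃ ~ u) where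

        -- Otherwise `u` is the centre of an induced star whose ends are the leaves of `L₂` and
        -- `L₃`, `x₁`, `leaf P` and `u⁺`.
        leaf-meets-succ : C ≡ [] ⊎ x₁ ~ u⁺
        leaf-meets-succ with last-out-tail r | adj? G x₁ u⁺
        ... | _               | yes e = inj₂ e
        ... | inj₁ eq         | no _  = inj₁ eq
        ... | inj₂ (l₁ , τ₁)  | no x₁≁u⁺ with last-out (path P) | last-out (path L₂) | last-out (path L₃)
        ...   | z , τ | l₂ , τ₂ | l₃ , τ₃ = ⊥-elim (no-star
          (↭-trans (↭-trans (solve 12 (λ c x₂ x₃ x₁ v z u u⁺ l₁ l₂ l₃ l₄ →
              (x₂ ⊕ x₃ ⊕ x₁ ⊕ v ⊕ u⁺ ⊕ c ⊕ u ⊕ z ⊕ l₁ ⊕ l₂ ⊕ l₃ ⊕ l₄)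
                ⊜ (c ⊕ ((v ⊕ z) ⊕ u ⊕ u⁺ ⊕ x₁ ⊕ l₁) ⊕ (x₂ ⊕ l₂) ⊕ (x₃ ⊕ l₃) ⊕ l₄)) ↭-refl
              (c ∷ []) (leaf L₂ ∷ []) (leaf L₃ ∷ []) (x₁ ∷ []) (leaf P ∷ []) z (u ∷ []) (u⁺ ∷ []) l₁ l₂ l₃ (body L₄))
            (prep c (Perm.++⁺ (Perm.++⁺ τ (prep u (prep u⁺ τ₁))) (Perm.++⁺ τ₂ (Perm.++⁺ τ₃ ↭-refl))))) (arrangement σ))
          (~-sym e₂ ∷ ~-sym e₃ ∷ ~-sym e₁ ∷ ~-sym g ∷ h ∷ [])
          (( leaves-nonadjacent L₂ L₃ L₁ L₄ (swap₂₃ (swap₁₂ σ))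
           ∷ leaves-nonadjacent L₂ L₁ L₃ L₄ (swap₁₂ σ)
           ∷ other-leaf-≁-pred p r′ L₃ L₂ L₄ (swap₂₃ σ) e₃
           ∷ other-leaf-≁-succ P L₂ L₃ L₄ g r σ e₃ ∷ [])
          ∷ ( leaves-nonadjacent L₃ L₁ L₂ L₄ (swap₁₂ (swap₂₃ σ))
           ∷ other-leaf-≁-pred p r′ L₂ L₃ L₄ σ e₂
           ∷ other-leaf-≁-succ P L₃ L₂ L₄ g r (swap₂₃ σ) e₂ ∷ [])
          ∷ ( own-leaf-≁-pred p r′ L₂ L₃ L₄ σ e₂ ∷ x₁≁u⁺ ∷ [])
          ∷ ( pred-≁-succ p (exact r) L₂ L₃ L₄ σ e₂ e₃ ∷ [])
          ∷ [] ∷ []))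

        -- By `leaf-meets-succ` the rest of the leg after `u` can be traversed completely from any
        -- `w` on it, so a leg whose leaf is adjacent to `w` could be continued through all of it.
        no-later : ∀ zs {us} → u⁺ ∷ C ≡ zs ++ w ∷ us → ¬ leaf L₂ ~ w × ¬ leaf L₃ ~ w × ¬ leaf L₄ ~ w
        no-later zs q with rotate r leaf-meets-succ zs q
        ... | _ , s = no-continuation p g s L₂ L₃ L₄ σ e₃
                    , no-continuation p g s L₃ L₂ L₄ (swap₂₃ σ) e₂
                    , no-continuation p g s L₄ L₂ L₃ (swap₂₃ (swap₃₄ σ)) e₂

    -- u is joined to c by four paths, and the leg Y hangs at c.
    record Theta (u : Fin n) (X₁ X₂ X₃ X₄ Y : Leg c) : Set where
      constructor theta
      field
        ends      : leaf X₁ ~ u × leaf X₂ ~ u × leaf X₃ ~ u × leaf X₄ ~ u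
        thetaSpan : u ∷ c ∷ body X₁ ++ body X₂ ++ body X₃ ++ body X₄ ++ body Y ↭ V

    module _ {c u : Fin n} where

      private
        variable
          X₁ X₂ X₃ X₄ Y : Leg c

      swapθ₁₂ : Theta u X₁ X₂ X₃ X₄ Y → Theta u X₂ X₁ X₃ X₄ Y
      swapθ₁₂ {X₁} {X₂} {X₃} {X₄} {Y} (theta (e₁ , e₂ , e₃ , e₄) σ) =
        theta (e₂ , e₁ , e₃ , e₄) (↭-trans (prep u (prep c (Perm.shifts (body X₂) (body X₁)))) σ)

      swapθ₂₃ : Theta u X₁ X₂ X₃ X₄ Y → Theta u X₁ X₃ X₂ X₄ Y
      swapθ₂₃ {X₁} {X₂} {X₃} {X₄} {Y} (theta (e₁ , e₂ , e₃ , e₄) σ) =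
        theta (e₁ , e₃ , e₂ , e₄)
          (↭-trans (prep u (prep c (Perm.++⁺ˡ (body X₁) (Perm.shifts (body X₃) (body X₂))))) σ)

      swapθ₃₄ : Theta u X₁ X₂ X₃ X₄ Y → Theta u X₁ X₂ X₄ X₃ Y
      swapθ₃₄ {X₁} {X₂} {X₃} {X₄} {Y} (theta (e₁ , e₂ , e₃ , e₄) σ) =
        theta (e₁ , e₂ , e₄ , e₃)
          (↭-trans (prep u (prep c (Perm.++⁺ˡ (body X₁) (Perm.++⁺ˡ (body X₂) (Perm.shifts (body X₄) (body X₃)))))) σ)

      -- The tripod is centred at `u`; the foot edge joins `X₁` to `X₂`, and `X₄` continues through
      -- `c` into `Y`.
      feet-nonadjacent : Theta u X₁ X₂ X₃ X₄ Y → ¬ foot X₁ ~ foot X₂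
      feet-nonadjacent {X₁} {X₂} {X₃} {X₄} {Y} (theta (e₁ , e₂ , e₃ , e₄) σ) e = no-tripod
        (point ⁀⟨ ~-sym e₁ ⟩ reverse (inner X₁) ⁀⟨ e ⟩ inner X₂)
        (point ⁀⟨ ~-sym e₃ ⟩ reverse (inner X₃))
        (point ⁀⟨ ~-sym e₄ ⟩ reverse (inner X₄) ⁀⟨ ~-sym (edge X₄) ⟩ full Y)
        (↭-trans (solve 7 (λ u c x₁ x₂ x₃ x₄ y →
            (u ⊕ (x₁ ⊕ x₂) ⊕ x₃ ⊕ (x₄ ⊕ c ⊕ y)) ⊜ (u ⊕ c ⊕ x₁ ⊕ x₂ ⊕ x₃ ⊕ x₄ ⊕ y)) ↭-refl
            (u ∷ []) (c ∷ []) (body X₁) (body X₂) (body X₃) (body X₄) (body Y)) σ)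

      -- Again centred at `u`: now `X₁` continues into `Y`, and `X₂` through `c` into `X₃`.
      fifth-foot-nonadjacent : Theta u X₁ X₂ X₃ X₄ Y → ¬ foot X₁ ~ foot Y
      fifth-foot-nonadjacent {X₁} {X₂} {X₃} {X₄} {Y} (theta (e₁ , e₂ , e₃ , e₄) σ) e = no-tripod
        (point ⁀⟨ ~-sym e₁ ⟩ reverse (inner X₁) ⁀⟨ e ⟩ inner Y)
        (point ⁀⟨ ~-sym e₂ ⟩ reverse (inner X₂) ⁀⟨ ~-sym (edge X₂) ⟩ full X₃)
        (point ⁀⟨ ~-sym e₄ ⟩ reverse (inner X₄))
        (↭-trans (solve 7 (λ u c x₁ x₂ x₃ x₄ y →
            (u ⊕ (x₁ ⊕ y) ⊕ (x₂ ⊕ c ⊕ x₃) ⊕ x₄) ⊜ (u ⊕ c ⊕ x₁ ⊕ x₂ ⊕ x₃ ⊕ x₄ ⊕ y)) ↭-refl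
            (u ∷ []) (c ∷ []) (body X₁) (body X₂) (body X₃) (body X₄) (body Y)) σ)

      -- The five feet would be the ends of an induced star with centre `c`.
      no-theta : ¬ Theta u X₁ X₂ X₃ X₄ Y
      no-theta {X₁} {X₂} {X₃} {X₄} {Y} θ
        with first-out X₁ | first-out X₂ | first-out X₃ | first-out X₄ | first-out Y
      ... | l₁ , τ₁ | l₂ , τ₂ | l₃ , τ₃ | l₄ , τ₄ | l₅ , τ₅ = no-star
        (↭-trans (↭-trans (solve 12 (λ u c x₁ x₂ x₃ x₄ y l₁ l₂ l₃ l₄ l₅ →
            (x₁ ⊕ x₂ ⊕ x₃ ⊕ x₄ ⊕ y ⊕ u ⊕ c ⊕ l₁ ⊕ l₂ ⊕ l₃ ⊕ l₄ ⊕ l₅)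
              ⊜ (u ⊕ c ⊕ (x₁ ⊕ l₁) ⊕ (x₂ ⊕ l₂) ⊕ (x₃ ⊕ l₃) ⊕ (x₄ ⊕ l₄) ⊕ y ⊕ l₅)) ↭-refl
            (u ∷ []) (c ∷ []) (foot X₁ ∷ []) (foot X₂ ∷ []) (foot X₃ ∷ []) (foot X₄ ∷ []) (foot Y ∷ [])
            l₁ l₂ l₃ l₄ l₅)
          (prep u (prep c (Perm.++⁺ τ₁ (Perm.++⁺ τ₂ (Perm.++⁺ τ₃ (Perm.++⁺ τ₄ τ₅))))))) (Theta.thetaSpan θ))
        (edge X₁ ∷ edge X₂ ∷ edge X₃ ∷ edge X₄ ∷ edge Y ∷ [])
        (( feet-nonadjacent θ
         ∷ feet-nonadjacent (swapθ₂₃ θ)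
         ∷ feet-nonadjacent (swapθ₂₃ (swapθ₃₄ θ))
         ∷ fifth-foot-nonadjacent θ ∷ [])
        ∷ ( feet-nonadjacent (swapθ₂₃ (swapθ₁₂ θ))
         ∷ feet-nonadjacent (swapθ₂₃ (swapθ₃₄ (swapθ₁₂ θ)))
         ∷ fifth-foot-nonadjacent (swapθ₁₂ θ) ∷ [])
        ∷ ( feet-nonadjacent (swapθ₂₃ (swapθ₁₂ (swapθ₃₄ (swapθ₂₃ θ))))
         ∷ fifth-foot-nonadjacent (swapθ₁₂ (swapθ₂₃ θ)) ∷ [])
        ∷ ( fifth-foot-nonadjacent (swapθ₁₂ (swapθ₂₃ (swapθ₃₄ θ))) ∷ [])
        ∷ [] ∷ [])

    -- With that edge the part of the leg after `u`, reversed, is a fourth path from `c` to `u`,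
    -- besides `P`, `L₂` and `L₃`.
    leaf-≁-centre : (P L₂ L₃ L₄ : Leg c) → leaf P ~ u → u ~ u⁺ → Path u⁺ C x₁ →
      Spans V c (body P ++ u ∷ C) (body L₂) (body L₃) (body L₄) →
      leaf L₂ ~ u → leaf L₃ ~ u → ¬ x₁ ~ c
    leaf-≁-centre {c} {u} {C = C} P L₂ L₃ L₄ g h r σ e₂ e₃ e with reverse (exact r)
    ... | C′ , r′ , τ = no-theta {Y = L₄} (theta {X₁ = P} {L₂} {L₃} {leg (~-sym e) r′} (g , e₂ , e₃ , ~-sym h)
      (↭-trans (↭-trans (solve 7 (λ u c z d l₂ l₃ l₄ →
          (u ⊕ c ⊕ z ⊕ l₂ ⊕ l₃ ⊕ d ⊕ l₄) ⊜ (c ⊕ (z ⊕ u ⊕ d) ⊕ l₂ ⊕ l₃ ⊕ l₄)) ↭-refl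
          (u ∷ []) (c ∷ []) (body P) C′ (body L₂) (body L₃) (body L₄))
        (prep c (Perm.++⁺ʳ _ (Perm.++⁺ˡ (body P) (prep u τ))))) (arrangement σ)))

    -- The facts above are the conditions of `OwnLeg`, with the edge from the leaf to the centre as
    -- `β`. At the foot `a` vanishes, which removes the correction term of `charged`.
    leg-bound : (L₁ L₂ L₃ L₄ : Leg c) → Spans V c (body L₁) (body L₂) (body L₃) (body L₄) →
      total (λ u → (χ (leaf L₂) u + χ (leaf L₃) u + χ (leaf L₄) u) + χ (leaf L₁) u) (body L₁) + χ (leaf L₁) c
        ≤ length (body L₁)
    leg-bound {c} L₁@(leg {A} {f} {x₁} e₁ p₁) L₂ L₃ L₄ σ = conclude p₁ σ (suffixes A charge)
      where
      x₂ = leaf L₂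
      x₃ = leaf L₃
      x₄ = leaf L₄

      a b : Fin n → ℕ
      a u = χ x₂ u + χ x₃ u + χ x₄ u
      b u = χ x₁ u

      open OwnLeg a b (χ x₁ c) (⟦⟧≤1 (adj? G x₁ c))

      Free : Fin n → Set
      Free u = ¬ x₂ ~ u × ¬ x₃ ~ u × ¬ x₄ ~ u

      free : ∀ {u} → Free u → a u ≡ 0
      free {u} (¬e₂ , ¬e₃ , ¬e₄)
        rewrite ⟦⟧≡0 (adj? G x₂ u) ¬e₂ | ⟦⟧≡0 (adj? G x₃ u) ¬e₃ | ⟦⟧≡0 (adj? G x₄ u) ¬e₄ = refl

      foot-free : ∀ {w us} → Path w (w ∷ us) x₁ → Spans V c (w ∷ us) (body L₂) (body L₃) (body L₄) → Free w
      foot-free r τ = other-leaf-≁-foot (exact r) L₂ L₃ L₄ τ ,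
                      other-leaf-≁-foot (exact r) L₃ L₂ L₄ (swap₂₃ τ) ,
                      other-leaf-≁-foot (exact r) L₄ L₂ L₃ (swap₂₃ (swap₃₄ τ))

      own-other-≁-pred : ∀ zs {w u us} → c ⟨ c ∷ zs ++ w ∷ [] ⟩ w → Path u (u ∷ us) x₁ → (M₂ M₃ M₄ : Leg c) →
        Spans V c (zs ++ w ∷ u ∷ us) (body M₂) (body M₃) (body M₄) →
        leaf M₂ ~ u → ¬ x₁ ~ w × ¬ leaf M₃ ~ w × ¬ leaf M₄ ~ w
      own-other-≁-pred zs p r M₂ M₃ M₄ τ g =
        own-leaf-≁-pred p (exact r) M₂ M₃ M₄ (shift-cut zs τ) g ,
        other-leaf-≁-pred p (exact r) M₂ M₃ M₄ (shift-cut zs τ) g ,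
        other-leaf-≁-pred p (exact r) M₂ M₄ M₃ (swap₃₄ (shift-cut zs τ)) g

      light : ∀ zs {w u us} → c ⟨ c ∷ zs ++ w ∷ [] ⟩ w → Path u (u ∷ us) x₁ →
        Spans V c (zs ++ w ∷ u ∷ us) (body L₂) (body L₃) (body L₄) → 1 ≤ a u → b w ≡ 0 × a w ≤ 1
      light zs {w} {u} p r τ 1≤a with one-of (adj? G x₂ u) (adj? G x₃ u) (adj? G x₄ u) 1≤a
      ... | inj₁ g = let ¬e₁ , ¬e₃ , ¬e₄ = own-other-≁-pred zs p r L₂ L₃ L₄ τ g in
        ⟦⟧≡0 (adj? G x₁ w) ¬e₁ , at-most-one (adj? G x₂ w) _ _ (¬e₃ ∘ proj₂) (¬e₄ ∘ proj₂) (¬e₃ ∘ proj₁)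
      ... | inj₂ (inj₁ g) = let ¬e₁ , ¬e₂ , ¬e₄ = own-other-≁-pred zs p r L₃ L₂ L₄ (swap₂₃ τ) g in
        ⟦⟧≡0 (adj? G x₁ w) ¬e₁ , at-most-one (adj? G x₂ w) _ _ (¬e₂ ∘ proj₁) (¬e₂ ∘ proj₁) (¬e₄ ∘ proj₂)
      ... | inj₂ (inj₂ g) = let ¬e₁ , ¬e₂ , ¬e₃ = own-other-≁-pred zs p r L₄ L₂ L₃ (swap₂₃ (swap₃₄ τ)) g in
        ⟦⟧≡0 (adj? G x₁ w) ¬e₁ , at-most-one (adj? G x₂ w) _ _ (¬e₂ ∘ proj₁) (¬e₂ ∘ proj₁) (¬e₃ ∘ proj₁)

      double : ∀ {w w⁺ us} (P M₂ M₃ M₄ : Leg c) → leaf P ~ w → w ~ w⁺ → Path w⁺ (w⁺ ∷ us) x₁ →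
        Spans V c (body P ++ w ∷ w⁺ ∷ us) (body M₂) (body M₃) (body M₄) →
        x₁ ~ w → leaf M₂ ~ w → leaf M₃ ~ w →
        χ x₁ c ≡ 0 × All (λ z → ¬ leaf M₂ ~ z × ¬ leaf M₃ ~ z × ¬ leaf M₄ ~ z) (w⁺ ∷ us)
      double P M₂ M₃ M₄ g h r τ e e₂ e₃ =
        ⟦⟧≡0 (adj? G x₁ c) (leaf-≁-centre P M₂ M₃ M₄ g h r τ e₂ e₃) ,
        All.tabulate λ z∈ → let zs , _ , eq = ∈-∃++ z∈ in no-later P M₂ M₃ M₄ g h r τ e e₂ e₃ zs eq

      charge : ∀ zs {w us} → A ≡ zs ++ w ∷ us → Charge w us
      -- The last vertex of the leg is the leaf `x₁` itself.
      charge zs {us = []} refl with split zs (e₁ ∷ p₁)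
      ... | _ , _ , _ , [-] =
        free ((λ e → leaves-nonadjacent L₂ L₁ L₃ L₄ (swap₁₂ σ) e)
            , (λ e → leaves-nonadjacent L₃ L₁ L₂ L₄ (swap₁₂ (swap₂₃ σ)) e)
            , (λ e → leaves-nonadjacent L₄ L₁ L₂ L₃ (swap₁₂ (swap₂₃ (swap₃₄ σ))) e))
        , ⟦⟧≡0 (adj? G x₁ x₁) (Graph.irrefl G refl)
      charge zs {w} {w⁺ ∷ us} refl with split zs (e₁ ∷ p₁)
      ... | w⁻ , q , g , r with h , r⁺ ← step r =
        light zs (exact q ⁀⟨ g ⟩ point) r⁺ σ , ≤2 zs q σ , ⟦⟧≤1 (adj? G x₁ w) , heavy-case zs q σ
        where
        ≤2 : ∀ zs → Path c (c ∷ zs) w⁻ → Spans V c (zs ++ w ∷ w⁺ ∷ us) (body L₂) (body L₃) (body L₄) → a w ≤ 2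
        ≤2 [] q σ = at-most-two (adj? G x₂ w) (adj? G x₃ w) (adj? G x₄ w)
          (λ (e , _) → proj₁ (foot-free r σ) e)
        ≤2 (z ∷ zs) q σ with i , q′ ← step q = at-most-two (adj? G x₂ w) (adj? G x₃ w) (adj? G x₄ w)
          (λ (e₂ , e₃ , e₄) → not-all-three (leg i q′) L₂ L₃ L₄ g h r⁺ σ e₂ e₃ e₄)

        heavy-case : ∀ zs → Path c (c ∷ zs) w⁻ → Spans V c (zs ++ w ∷ w⁺ ∷ us) (body L₂) (body L₃) (body L₄) →
          a w ≡ 2 → b w ≡ 1 → χ x₁ c ≡ 0 × All (λ z → a z ≡ 0) (w⁺ ∷ us)
        heavy-case zs q σ a≡2 b≡1 with adj? G x₁ w
        heavy-case []       q σ a≡2 b≡1 | yes e with () ← trans (sym a≡2) (free (foot-free r σ))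
        heavy-case (z ∷ zs) q σ a≡2 b≡1 | yes e with two-of (adj? G x₂ w) (adj? G x₃ w) (adj? G x₄ w) a≡2
        ... | inj₁ (e₂ , e₃) =
          let β≡0 , fs = double (leg (proj₁ (step q)) (proj₂ (step q))) L₂ L₃ L₄ g h r⁺ σ e e₂ e₃ in
          β≡0 , All.map free fs
        ... | inj₂ (inj₁ (e₂ , e₄)) =
          let β≡0 , fs = double (leg (proj₁ (step q)) (proj₂ (step q))) L₂ L₄ L₃ g h r⁺ (swap₃₄ σ) e e₂ e₄ in
          β≡0 , All.map (λ (f₂ , f₄ , f₃) → free (f₂ , f₃ , f₄)) fs
        ... | inj₂ (inj₂ (e₃ , e₄)) =
          let β≡0 , fs = double (leg (proj₁ (step q)) (proj₂ (step q))) L₃ L₄ L₂ g h r⁺ (swap₃₄ (swap₂₃ σ)) e e₃ e₄ in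
          β≡0 , All.map (λ (f₃ , f₄ , f₂) → free (f₂ , f₃ , f₄)) fs

      first-free : ∀ {us} → Path f (f ∷ us) x₁ → Spans V c (f ∷ us) (body L₂) (body L₃) (body L₄) →
        Suffixes Charge (f ∷ us) → total (λ u → a u + b u) (f ∷ us) + χ x₁ c ≤ suc (length us)
      first-free {us} r τ s = ℕ.≤-trans (charged s) (ℕ.≤-reflexive
        (trans (cong (λ k → suc (length us) + positive k) (free (foot-free r τ))) (ℕ.+-identityʳ _)))

      conclude : ∀ {A} → Path f A x₁ → Spans V c A (body L₂) (body L₃) (body L₄) →
        Suffixes Charge A → total (λ u → a u + b u) A + χ x₁ c ≤ length A
      -- Matching on the path reveals that `A` begins with the foot `f`.
      conclude r@[-]     = first-free r
      conclude r@(_ ∷ _) = first-free r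

    -- An edge from a leaf to `c` is counted with the leg of that leaf. The vertex `c` is left over
    -- and makes the inequality strict.
    spider-bound : (L₁ L₂ L₃ L₄ : Leg c) → Spans V c (body L₁) (body L₂) (body L₃) (body L₄) →
      total (λ u → χ (leaf L₁) u + χ (leaf L₂) u + χ (leaf L₃) u + χ (leaf L₄) u) V < length V
    spider-bound {c} L₁ L₂ L₃ L₄ σ = begin-strict
      total wt V
        ≡⟨ total-↭ wt (↭-sym (arrangement σ)) ⟩
      wt c + total wt (A₁ ++ A₂ ++ A₃ ++ A₄)
        ≡⟨ cong (wt c +_) (total-++₄ wt A₁ A₂ A₃ A₄) ⟩
      wt c + (total wt A₁ + (total wt A₂ + (total wt A₃ + total wt A₄)))
        ≡⟨ cong (wt c +_)
             (cong₂ _+_ (total-cong (λ u → lemma₁ (d₁ u) (d₂ u) (d₃ u) (d₄ u)) A₁)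
             (cong₂ _+_ (total-cong (λ u → lemma₂ (d₁ u) (d₂ u) (d₃ u) (d₄ u)) A₂)
             (cong₂ _+_ (total-cong (λ u → lemma₃ (d₁ u) (d₂ u) (d₃ u) (d₄ u)) A₃) refl))) ⟩
      wt c + (total _ A₁ + (total _ A₂ + (total _ A₃ + total wt A₄)))
        ≡⟨ lemma (d₁ c) (d₂ c) (d₃ c) (d₄ c) (total _ A₁) (total _ A₂) (total _ A₃) (total wt A₄) ⟩
      (total _ A₁ + d₁ c) + ((total _ A₂ + d₂ c) + ((total _ A₃ + d₃ c) + (total wt A₄ + d₄ c)))
        ≤⟨ ℕ.+-mono-≤ (leg-bound L₁ L₂ L₃ L₄ σ) (ℕ.+-mono-≤ (leg-bound L₂ L₁ L₃ L₄ (swap₁₂ σ))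
             (ℕ.+-mono-≤ (leg-bound L₃ L₁ L₂ L₄ (swap₁₂ (swap₂₃ σ)))
                            (leg-bound L₄ L₁ L₂ L₃ (swap₁₂ (swap₂₃ (swap₃₄ σ)))))) ⟩
      length A₁ + (length A₂ + (length A₃ + length A₄))                     ≡⟨ length-++₄ A₁ A₂ A₃ A₄ ⟨
      length (A₁ ++ A₂ ++ A₃ ++ A₄)                                         <⟨ ℕ.n<1+n _ ⟩
      length (c ∷ A₁ ++ A₂ ++ A₃ ++ A₄)                                     ≡⟨ Perm.↭-length (arrangement σ) ⟩
      length V                                                              ∎
      where
      open ℕ.≤-Reasoning
      A₁ = body L₁
      A₂ = body L₂
      A₃ = body L₃
      A₄ = body L₄
      d₁ d₂ d₃ d₄ wt : Fin n → ℕ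
      d₁ = χ (leaf L₁)
      d₂ = χ (leaf L₂)
      d₃ = χ (leaf L₃)
      d₄ = χ (leaf L₄)
      wt u = d₁ u + d₂ u + d₃ u + d₄ u
      lemma₁ : ∀ a b c d → a + b + c + d ≡ (b + c + d) + a
      lemma₁ = solve-∀
      lemma₂ : ∀ a b c d → a + b + c + d ≡ (a + c + d) + b
      lemma₂ = solve-∀
      lemma₃ : ∀ a b c d → a + b + c + d ≡ (a + b + d) + c
      lemma₃ = solve-∀
      lemma : ∀ a b c d t₁ t₂ t₃ t₄ → (a + b + c + d) + (t₁ + (t₂ + (t₃ + t₄))) ≡
                                      (t₁ + a) + ((t₂ + b) + ((t₃ + c) + (t₄ + d)))
      lemma = solve-∀

-- Trees with two hubs

module Trunks {n : ℕ} (G : Graph n) where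
  open Paths G
  open Legs G

  private
    variable
      s t : Fin n
      P l₁ l₂ l₃ l₄ U : List (Fin n)

  -- A path from `s` to `t` with interior `P`, possibly empty. The last edge is kept apart so that
  -- the trunk can be used with or without the hub `t`.
  Link : Fin n → List (Fin n) → Fin n → Set
  Link s P t = ∃[ w ] s ⟨ s ∷ P ⟩ w × w ~ t

  flip : Link s P t → Link t P s
  flip (w , p , e) with uncons p
  ... | inj₁ (refl , refl) = _ , point , ~-sym e
  ... | inj₂ (q , f , p′)  = _ , point ⁀⟨ ~-sym e ⟩ reverse p′ , ~-sym f

  record Spans² (U : List (Fin n)) (s t : Fin n) (P l₁ l₂ l₃ l₄ : List (Fin n)) : Set where
    constructor spans²
    field arrangement² : s ∷ t ∷ P ++ l₁ ++ l₂ ++ l₃ ++ l₄ ↭ U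

  open Spans² public

  swapˢ : Spans² U s t P l₁ l₂ l₃ l₄ → Spans² U s t P l₂ l₁ l₃ l₄
  swapˢ {P = P} {l₁} {l₂} (spans² σ) =
    spans² (↭-trans (prep _ (prep _ (Perm.++⁺ˡ P (Perm.shifts l₂ l₁)))) σ)

  swapᵗ : Spans² U s t P l₁ l₂ l₃ l₄ → Spans² U s t P l₁ l₂ l₄ l₃
  swapᵗ {P = P} {l₁} {l₂} {l₃} {l₄} (spans² σ) =
    spans² (↭-trans (prep _ (prep _ (Perm.++⁺ˡ P (Perm.++⁺ˡ l₁ (Perm.++⁺ˡ l₂ (Perm.++-comm l₄ l₃)))))) σ)

  turn : Spans² U s t P l₁ l₂ l₃ l₄ → Spans² U t s P l₃ l₄ l₁ l₂
  turn {s = s} {t} {P} {l₁} {l₂} {l₃} {l₄} (spans² σ) = spans² (↭-trans (solve 7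
    (λ s t p l₁ l₂ l₃ l₄ → (t ⊕ s ⊕ p ⊕ l₃ ⊕ l₄ ⊕ l₁ ⊕ l₂) ⊜ (s ⊕ t ⊕ p ⊕ l₁ ⊕ l₂ ⊕ l₃ ⊕ l₄)) ↭-refl
    (s ∷ []) (t ∷ []) P l₁ l₂ l₃ l₄) σ)

  retrunk : ∀ {P′} → P′ ↭ P → Spans² U s t P l₁ l₂ l₃ l₄ → Spans² U s t P′ l₁ l₂ l₃ l₄
  retrunk τ (spans² σ) = spans² (↭-trans (prep _ (prep _ (Perm.++⁺ʳ _ τ))) σ)

-- Counting the neighbours of the leaves of a two-hub tree with longest trunk

module LongestTrunk {n : ℕ} (G : Graph n) (V : List (Fin n)) (k : ℕ) where
  open Paths G
  open Legs G
  open Trunks G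

  module _
    (no-spider : ∀ {c l₁ l₂ l₃ l₄ x₁ x₂ x₃ x₄} →
                 c ⟨ c ∷ l₁ ⟩ x₁ → c ⟨ c ∷ l₂ ⟩ x₂ → c ⟨ c ∷ l₃ ⟩ x₃ → c ⟨ c ∷ l₄ ⟩ x₄ →
                 ¬ (c ∷ l₁ ++ l₂ ++ l₃ ++ l₄ ↭ V))
    -- Only trees on the same vertex set `V` compete for the longest trunk.
    (no-longer : ∀ {s t P l₁ l₂ l₃ l₄ x₁ x₂ x₃ x₄} → Link s P t →
                 s ⟨ s ∷ l₁ ⟩ x₁ → s ⟨ s ∷ l₂ ⟩ x₂ → t ⟨ t ∷ l₃ ⟩ x₃ → t ⟨ t ∷ l₄ ⟩ x₄ →
                 k < length P → ¬ (s ∷ t ∷ P ++ l₁ ++ l₂ ++ l₃ ++ l₄ ↭ V))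
    where

    private
      variable
        s t u u⁻ w p x₃ : Fin n
        P Q R Z C : List (Fin n)

    module _ (L₁ L₂ : Leg s) (L₃ L₄ : Leg t) where

      private
        A₁ = body L₁
        A₂ = body L₂
        A₃ = body L₃
        A₄ = body L₄

      -- Both legs at `s` become the end of a single leg at `t` that starts with the trunk. The
      -- fourth leg of the spider is empty.
      same-side-nonadjacent : Link s P t → Spans² V s t P A₁ A₂ A₃ A₄ → ¬ leaf L₁ ~ leaf L₂
      same-side-nonadjacent {P} T σ e with flip T
      ... | _ , q , f = no-spider (full L₃) (full L₄) (q ⁀⟨ f ⟩ full L₁ ⁀⟨ e ⟩ reverse (inner L₂)) point
        (↭-trans (solve 7 (λ s t p l₁ l₂ l₃ l₄ →
            (t ⊕ l₃ ⊕ l₄ ⊕ (p ⊕ (s ⊕ l₁) ⊕ l₂) ⊕ id) ⊜ (s ⊕ t ⊕ p ⊕ l₁ ⊕ l₂ ⊕ l₃ ⊕ l₄)) ↭-refl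
            (s ∷ []) (t ∷ []) P A₁ A₂ A₃ A₄) (arrangement² σ))

      -- `L₃` is continued through `L₁`, `s` and `L₂`, and the trunk without `s` is a leg of its own
      -- at `t`.
      opposite-nonadjacent : Link s P t → Spans² V s t P A₁ A₂ A₃ A₄ → ¬ leaf L₁ ~ leaf L₃
      opposite-nonadjacent {P} T σ e with flip T
      ... | _ , q , f = no-spider (full L₄) q (full L₃ ⁀⟨ ~-sym e ⟩ bend (full L₁) (full L₂)) point
        (↭-trans (solve 7 (λ s t p l₁ l₂ l₃ l₄ →
            (t ⊕ l₄ ⊕ p ⊕ (l₃ ⊕ s ⊕ l₁ ⊕ l₂) ⊕ id) ⊜ (s ⊕ t ⊕ p ⊕ l₁ ⊕ l₂ ⊕ l₃ ⊕ l₄)) ↭-refl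
            (s ∷ []) (t ∷ []) P A₁ A₂ A₃ A₄) (arrangement² σ))

      -- `L₁` is hung at `t` by its leaf, and the trunk continues into `L₂`.
      leaf-≁-far-hub : Link s P t → Spans² V s t P A₁ A₂ A₃ A₄ → ¬ leaf L₁ ~ t
      leaf-≁-far-hub {P} T σ e with flip T
      ... | _ , q , f = no-spider (full L₃) (full L₄) (q ⁀⟨ f ⟩ full L₂) (point ⁀⟨ ~-sym e ⟩ reverse (inner L₁))
        (↭-trans (solve 7 (λ s t p l₁ l₂ l₃ l₄ →
            (t ⊕ l₃ ⊕ l₄ ⊕ (p ⊕ s ⊕ l₂) ⊕ l₁) ⊜ (s ⊕ t ⊕ p ⊕ l₁ ⊕ l₂ ⊕ l₃ ⊕ l₄)) ↭-refl
            (s ∷ []) (t ∷ []) P A₁ A₂ A₃ A₄) (arrangement² σ))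

    -- One leg at t is Z ++ u ∷ C with leaf x₃, and u⁻ precedes u on it.
    module _ (L₁ L₂ : Leg s) (L₄ : Leg t) (T : Link s P t) (q : t ⟨ t ∷ Z ⟩ u⁻) (g : u⁻ ~ u) (r : u ⟨ u ∷ C ⟩ x₃)
             (σ : Spans² V s t P (body L₁) (body L₂) (Z ++ u ∷ C) (body L₄)) where

      private
        A₁ = body L₁
        A₂ = body L₂
        A₄ = body L₄

      -- Otherwise `u` replaces `t` as a hub, with `L₄` reversed as a leg, and the trunk gains `t`
      -- and `Z`.
      twin-leaf-nonadjacent : k ≡ length P → ¬ leaf L₄ ~ u
      twin-leaf-nonadjacent k≡ e = let _ , q′ , f = T in no-longer (_ , q′ ⁀⟨ f ⟩ q , g) (full L₁) (full L₂)
        (point ⁀⟨ ~-sym e ⟩ reverse (inner L₄)) r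
        (ℕ.≤-<-trans (ℕ.≤-reflexive k≡) (subst (length P <_) (sym (length-++ P)) (ℕ.m<m+n (length P) (s≤s z≤n))))
        (↭-trans (solve 9 (λ s t p l₁ l₂ z u d l₄ →
            (s ⊕ u ⊕ (p ⊕ t ⊕ z) ⊕ l₁ ⊕ l₂ ⊕ l₄ ⊕ d) ⊜ (s ⊕ t ⊕ p ⊕ l₁ ⊕ l₂ ⊕ (z ⊕ u ⊕ d) ⊕ l₄)) ↭-refl
            (s ∷ []) (t ∷ []) P A₁ A₂ Z (u ∷ []) C A₄) (arrangement² σ))

      -- Otherwise `u` replaces `s` as a hub: the trunk from `t` is prolonged by `s` and `L₁`, and
      -- `L₂` hangs at `u` by its leaf.
      not-both-far-leaves : k ≡ length P → leaf L₁ ~ u → ¬ leaf L₂ ~ u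
      not-both-far-leaves k≡ e₁ e₂ with flip T
      ... | _ , q′ , f = no-longer (_ , q′ ⁀⟨ f ⟩ full L₁ , e₁) (full L₄) q
        (point ⁀⟨ ~-sym e₂ ⟩ reverse (inner L₂)) r
        (ℕ.≤-<-trans (ℕ.≤-reflexive k≡) (subst (length P <_) (sym (length-++ P)) (ℕ.m<m+n (length P) (s≤s z≤n))))
        (↭-trans (solve 9 (λ s t p l₁ l₂ z u d l₄ →
            (t ⊕ u ⊕ (p ⊕ s ⊕ l₁) ⊕ l₄ ⊕ z ⊕ l₂ ⊕ d) ⊜ (s ⊕ t ⊕ p ⊕ l₁ ⊕ l₂ ⊕ (z ⊕ u ⊕ d) ⊕ l₄)) ↭-refl
            (s ∷ []) (t ∷ []) P A₁ A₂ Z (u ∷ []) C A₄) (arrangement² σ))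

      -- The leg would be rerouted from `u⁻` to `x₃`, back to `u`, and on through `L₁`, `s` and
      -- `L₂`.
      own-leaf-≁-pred : leaf L₁ ~ u → ¬ x₃ ~ u⁻
      own-leaf-≁-pred e₁ e₃ with flip T
      ... | _ , q′ , f = no-spider (full L₄) q′
        (q ⁀⟨ ~-sym e₃ ⟩ reverse r ⁀⟨ ~-sym e₁ ⟩ bend (full L₁) (full L₂)) point
        (↭-trans (solve 9 (λ s t p l₁ l₂ z u d l₄ →
            (t ⊕ l₄ ⊕ p ⊕ (z ⊕ (u ⊕ d) ⊕ s ⊕ l₁ ⊕ l₂) ⊕ id) ⊜ (s ⊕ t ⊕ p ⊕ l₁ ⊕ l₂ ⊕ (z ⊕ u ⊕ d) ⊕ l₄)) ↭-refl
            (s ∷ []) (t ∷ []) P A₁ A₂ Z (u ∷ []) C A₄) (arrangement² σ))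

    -- A vertex p of the trunk splits it into Q and R.
    module _ (L₁ L₂ : Leg s) (L₃ L₄ : Leg t) where

      private
        A₁ = body L₁
        A₂ = body L₂
        A₃ = body L₃
        A₄ = body L₄

      -- The vertex `p` would be the centre of a spider: two legs hang by their leaves, and the two
      -- halves of the trunk continue into the other two.
      not-both-sides : Link s Q p → Link t R p → Spans² V s t (Q ++ p ∷ R) A₁ A₂ A₃ A₄ →
        leaf L₁ ~ p → ¬ leaf L₃ ~ p
      not-both-sides {Q} {p} {R} (_ , q , g) (_ , r , h) σ e₁ e₃ = no-spider
        (point ⁀⟨ ~-sym e₁ ⟩ reverse (inner L₁)) (point ⁀⟨ ~-sym e₃ ⟩ reverse (inner L₃))
        (point ⁀⟨ ~-sym g ⟩ bend q (full L₂)) (point ⁀⟨ ~-sym h ⟩ bend r (full L₄))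
        (↭-trans (solve 9 (λ s t q p r l₁ l₂ l₃ l₄ →
            (p ⊕ l₁ ⊕ l₃ ⊕ (s ⊕ q ⊕ l₂) ⊕ (t ⊕ r ⊕ l₄)) ⊜ (s ⊕ t ⊕ (q ⊕ p ⊕ r) ⊕ l₁ ⊕ l₂ ⊕ l₃ ⊕ l₄)) ↭-refl
            (s ∷ []) (t ∷ []) Q (p ∷ []) R A₁ A₂ A₃ A₄) (arrangement² σ))

      -- The edge from `s` to `p` could be replaced by the one from `leaf L₁`, so that `s` is no
      -- longer a hub.
      first-nonadjacent : Link t R p → Spans² V s t (p ∷ R) A₁ A₂ A₃ A₄ → ¬ leaf L₁ ~ p
      first-nonadjacent {R} {p} (_ , r , h) σ e₁ = no-spider (full L₃) (full L₄)
        (r ⁀⟨ h ⟩ point ⁀⟨ ~-sym e₁ ⟩ bend (full L₁) (full L₂)) point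
        (↭-trans (solve 8 (λ s t p r l₁ l₂ l₃ l₄ →
            (t ⊕ l₃ ⊕ l₄ ⊕ (r ⊕ p ⊕ s ⊕ l₁ ⊕ l₂) ⊕ id) ⊜ (s ⊕ t ⊕ (p ⊕ r) ⊕ l₁ ⊕ l₂ ⊕ l₃ ⊕ l₄)) ↭-refl
            (s ∷ []) (t ∷ []) (p ∷ []) R A₁ A₂ A₃ A₄) (arrangement² σ))

      -- `K` is the trunk between `s` and `p` viewed as a leg at `s`, so `leaf K` is the vertex
      -- before `p`.
      module _ (K : Leg s) (T : Link t R p) (σ : Spans² V s t (body K ++ p ∷ R) A₁ A₂ A₃ A₄) where

        same-side-≁-pred : leaf L₁ ~ p → ¬ leaf L₂ ~ leaf K
        same-side-≁-pred e₁ e₂ = let _ , r , h = T in no-spider (full L₃) (full L₄)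
          (r ⁀⟨ h ⟩ point ⁀⟨ ~-sym e₁ ⟩ bend (full L₁) (full K) ⁀⟨ ~-sym e₂ ⟩ reverse (inner L₂)) point
          (↭-trans (solve 9 (λ s t q p r l₁ l₂ l₃ l₄ →
              (t ⊕ l₃ ⊕ l₄ ⊕ (r ⊕ p ⊕ (s ⊕ l₁ ⊕ q) ⊕ l₂) ⊕ id) ⊜ (s ⊕ t ⊕ (q ⊕ p ⊕ r) ⊕ l₁ ⊕ l₂ ⊕ l₃ ⊕ l₄)) ↭-refl
              (s ∷ []) (t ∷ []) (body K) (p ∷ []) R A₁ A₂ A₃ A₄) (arrangement² σ))

        opposite-≁-pred : leaf L₁ ~ p → ¬ leaf L₃ ~ leaf K
        opposite-≁-pred e₁ e₃ = let _ , r , h = T in no-spider (full L₄) (full L₃ ⁀⟨ e₃ ⟩ reverse (inner K))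
          (r ⁀⟨ h ⟩ point ⁀⟨ ~-sym e₁ ⟩ bend (full L₁) (full L₂)) point
          (↭-trans (solve 9 (λ s t q p r l₁ l₂ l₃ l₄ →
              (t ⊕ l₄ ⊕ (l₃ ⊕ q) ⊕ (r ⊕ p ⊕ s ⊕ l₁ ⊕ l₂) ⊕ id) ⊜ (s ⊕ t ⊕ (q ⊕ p ⊕ r) ⊕ l₁ ⊕ l₂ ⊕ l₃ ⊕ l₄)) ↭-refl
              (s ∷ []) (t ∷ []) (body K) (p ∷ []) R A₁ A₂ A₃ A₄) (arrangement² σ))

      -- This keeps `z` from paying on both sides. The spider is centred at `y` and has `z` alone as
      -- one of its legs.
      no-shared-gap : ∀ {y z v} → Link s Q y → y ~ z → Link t R v →
        Spans² V s t (Q ++ y ∷ z ∷ v ∷ R) A₁ A₂ A₃ A₄ → leaf L₃ ~ y → leaf L₄ ~ y → ¬ leaf L₂ ~ v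
      no-shared-gap {Q} {R} {y} {z} {v} (_ , q , g) f (_ , r , h) σ e₃ e₄ e₂ = no-spider
        (point ⁀⟨ ~-sym e₄ ⟩ reverse (inner L₄)) (point ⁀⟨ f ⟩ point)
        (point ⁀⟨ ~-sym e₃ ⟩ reverse (inner L₃) ⁀⟨ ~-sym (edge L₃) ⟩ r ⁀⟨ h ⟩ point ⁀⟨ ~-sym e₂ ⟩ reverse (inner L₂))
        (point ⁀⟨ ~-sym g ⟩ bend q (full L₁))
        (↭-trans (solve 11 (λ s t q y z v r l₁ l₂ l₃ l₄ →
            (y ⊕ l₄ ⊕ z ⊕ (l₃ ⊕ (t ⊕ r) ⊕ v ⊕ l₂) ⊕ (s ⊕ q ⊕ l₁))
              ⊜ (s ⊕ t ⊕ (q ⊕ y ⊕ z ⊕ v ⊕ r) ⊕ l₁ ⊕ l₂ ⊕ l₃ ⊕ l₄)) ↭-refl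
            (s ∷ []) (t ∷ []) Q (y ∷ []) (z ∷ []) (v ∷ []) R A₁ A₂ A₃ A₄) (arrangement² σ))

    -- `Staggered` is applied to `t ∷ A`, so that an edge from `x₃` to its hub is counted with the
    -- leg.
    leg-bound : (L₁ L₂ : Leg s) (L₃ L₄ : Leg t) → Link s P t → k ≡ length P →
      Spans² V s t P (body L₁) (body L₂) (body L₃) (body L₄) →
      total (λ u → (χ (leaf L₁) u + χ (leaf L₂) u + χ (leaf L₄) u) + χ (leaf L₃) u) (body L₃) + χ (leaf L₃) t
        ≤ length (body L₃)
    leg-bound {t = t} {P} L₁ L₂ (leg {A} {f} {x₃} e₃ p₃) L₄ T k≡ σ = staggered (suffixes (t ∷ A) edges)
      where
      x₁ = leaf L₁
      x₂ = leaf L₂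
      x₄ = leaf L₄

      a b : Fin n → ℕ
      a u = χ x₁ u + χ x₂ u + χ x₄ u
      b u = χ x₃ u

      open Staggered a b

      consecutive : ∀ {Z w u us} → t ⟨ t ∷ Z ⟩ w → w ~ u → Path u (u ∷ us) x₃ →
        Spans² V _ t P (body L₁) (body L₂) (Z ++ u ∷ us) (body L₄) → a u + b w ≤ 1
      consecutive {w = w} {u} q g r τ with adj? G x₃ w
      ... | no _  = subst (_≤ 1) (sym (ℕ.+-identityʳ _)) (at-most-one (adj? G x₁ u) (adj? G x₂ u) (adj? G x₄ u)
        (λ (e₁ , e₂) → not-both-far-leaves L₁ L₂ L₄ T q g (exact r) τ k≡ e₁ e₂)
        (λ (_ , e₄) → twin-leaf-nonadjacent L₁ L₂ L₄ T q g (exact r) τ k≡ e₄)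
        (λ (_ , e₄) → twin-leaf-nonadjacent L₁ L₂ L₄ T q g (exact r) τ k≡ e₄))
      ... | yes e = ℕ.≤-reflexive (cong (_+ 1) (trans
        (cong (_+ χ x₄ u) (sum-zero (adj? G x₁ u) (adj? G x₂ u)
          (λ e₁ → own-leaf-≁-pred L₁ L₂ L₄ T q g (exact r) τ e₁ e)
          (λ e₂ → own-leaf-≁-pred L₂ L₁ L₄ T q g (exact r) (swapˢ τ) e₂ e)))
        (⟦⟧≡0 (adj? G x₄ u) (λ e₄ → twin-leaf-nonadjacent L₁ L₂ L₄ T q g (exact r) τ k≡ e₄))))

      edges : ∀ zs {w us} → t ∷ A ≡ zs ++ w ∷ us → Edge w us
      edges []       {us = []}     refl = ⊥-elim (no-empty-path p₃)
      edges []       {us = u ∷ us} refl =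
        let _ , r = step (e₃ ∷ p₃) in consecutive {Z = []} point (proj₁ (step (e₃ ∷ p₃))) r σ
      edges (_ ∷ zs) {us = []}     refl with split zs (e₃ ∷ p₃)
      ... | _ , _ , _ , [-] = ⟦⟧≡0 (adj? G x₃ x₃) (Graph.irrefl G refl)
      edges (_ ∷ zs) {w} {us = u ∷ us} refl with split zs (e₃ ∷ p₃)
      ... | _ , q , g , r = consecutive {Z = zs ++ w ∷ []} (exact q ⁀⟨ g ⟩ point) (proj₁ (step r)) (proj₂ (step r))
        (subst (λ l → Spans² V _ t P _ _ l _) (sym (++-assoc zs (w ∷ []) (u ∷ us))) σ)

    -- `Gaps` is applied with the leaves at `s` counted by `l` and those at `t` by `r`. The trunk is
    -- given as an ordered path because the order of `P` matters here.
    trunk-bound : (L₁ L₂ : Leg s) (L₃ L₄ : Leg t) → Path s (s ∷ P) w → w ~ t →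
      Spans² V s t P (body L₁) (body L₂) (body L₃) (body L₄) →
      total (λ u → (χ (leaf L₁) u + χ (leaf L₂) u) + (χ (leaf L₃) u + χ (leaf L₄) u)) P ≤ length P
    trunk-bound {s} {t} {P} {z} L₁ L₂ L₃ L₄ q₀ e₀ σ = conclude P refl (suffixes P gap)
      where
      l r : Fin n → ℕ
      l u = χ (leaf L₁) u + χ (leaf L₂) u
      r u = χ (leaf L₃) u + χ (leaf L₄) u

      open Gaps l r (λ u → ℕ.+-mono-≤ (⟦⟧≤1 (adj? G (leaf L₁) u)) (⟦⟧≤1 (adj? G (leaf L₂) u)))
                    (λ u → ℕ.+-mono-≤ (⟦⟧≤1 (adj? G (leaf L₃) u)) (⟦⟧≤1 (adj? G (leaf L₄) u)))

      Placed : List (Fin n) → Set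
      Placed P′ = Spans² V s t P′ (body L₁) (body L₂) (body L₃) (body L₄)

      last-dark : ∀ {Q p} → Link s Q p → Placed (Q ++ p ∷ []) → r p ≡ 0
      last-dark {Q} {p} T τ = sum-zero (adj? G (leaf L₃) p) (adj? G (leaf L₄) p)
        (first-nonadjacent L₃ L₄ L₁ L₂ T (turn τ′))
        (first-nonadjacent L₄ L₃ L₁ L₂ T (swapˢ (turn τ′)))
        where
        τ′ : Placed (p ∷ Q)
        τ′ = retrunk (Perm.∷↭∷ʳ p Q) τ

      one-sided : ∀ {Q p R} → Link s Q p → Link t R p → Placed (Q ++ p ∷ R) → l p ≡ 0 ⊎ r p ≡ 0
      one-sided {p = p} T T′ τ with adj? G (leaf L₁) p | adj? G (leaf L₂) p
      ... | no _   | no _   = inj₁ refl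
      ... | yes e₁ | _      = inj₂ (sum-zero (adj? G (leaf L₃) p) (adj? G (leaf L₄) p)
        (not-both-sides L₁ L₂ L₃ L₄ T T′ τ e₁) (not-both-sides L₁ L₂ L₄ L₃ T T′ (swapᵗ τ) e₁))
      ... | no _   | yes e₂ = inj₂ (sum-zero (adj? G (leaf L₃) p) (adj? G (leaf L₄) p)
        (not-both-sides L₂ L₁ L₃ L₄ T T′ (swapˢ τ) e₂) (not-both-sides L₂ L₁ L₄ L₃ T T′ (swapᵗ (swapˢ τ)) e₂))

      before : ∀ (K : Leg s) {p R} → Link t R p → Placed (body K ++ p ∷ R) → l p ≡ 2 → l (leaf K) ≡ 0 × r (leaf K) ≡ 0
      before K {p} T τ l≡2 = let e₁ , e₂ = both (adj? G (leaf L₁) p) (adj? G (leaf L₂) p) l≡2 in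
        sum-zero (adj? G (leaf L₁) (leaf K)) (adj? G (leaf L₂) (leaf K))
          (same-side-≁-pred L₂ L₁ L₃ L₄ K T (swapˢ τ) e₂) (same-side-≁-pred L₁ L₂ L₃ L₄ K T τ e₁) ,
        sum-zero (adj? G (leaf L₃) (leaf K)) (adj? G (leaf L₄) (leaf K))
          (opposite-≁-pred L₁ L₂ L₃ L₄ K T τ e₁) (opposite-≁-pred L₁ L₂ L₄ L₃ K T (swapᵗ τ) e₁)

      after : ∀ (K : Leg t) {p Q} → Link s Q p → Placed (body K ++ p ∷ Q) → r p ≡ 2 → l (leaf K) ≡ 0 × r (leaf K) ≡ 0
      after K {p} T τ r≡2 = let e₃ , e₄ = both (adj? G (leaf L₃) p) (adj? G (leaf L₄) p) r≡2 in
        sum-zero (adj? G (leaf L₁) (leaf K)) (adj? G (leaf L₂) (leaf K))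
          (opposite-≁-pred L₃ L₄ L₁ L₂ K T (turn τ) e₃) (opposite-≁-pred L₃ L₄ L₂ L₁ K T (swapᵗ (turn τ)) e₃) ,
        sum-zero (adj? G (leaf L₃) (leaf K)) (adj? G (leaf L₄) (leaf K))
          (same-side-≁-pred L₄ L₃ L₁ L₂ K T (swapˢ (turn τ)) e₄) (same-side-≁-pred L₃ L₄ L₁ L₂ K T (turn τ) e₃)

      unlit : ∀ {Q p q R} → Link s Q p → p ~ q → Path q (q ∷ R) z → Placed (Q ++ p ∷ q ∷ R) → r p ≡ 2 → Unlit R
      unlit {R = []}    _ _ _  _ _ = tt
      unlit {p = p} {R = v ∷ R} T g p′ τ r≡2 =
        let e₃ , e₄ = both (adj? G (leaf L₃) p) (adj? G (leaf L₄) p) r≡2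
            _ , p″  = step p′
            T′      = flip (z , exact p″ , e₀)
        in sum-zero (adj? G (leaf L₁) v) (adj? G (leaf L₂) v)
             (no-shared-gap L₂ L₁ L₃ L₄ T g T′ (swapˢ τ) e₃ e₄) (no-shared-gap L₁ L₂ L₃ L₄ T g T′ τ e₃ e₄)

      gap : ∀ zs {p us} → P ≡ zs ++ p ∷ us → Gap p us
      gap zs {p} {us} refl with split zs q₀
      gap zs {p} {[]}     refl | y , q , g , r = last-dark (y , exact q , g) σ
      gap zs {p} {v ∷ us} refl | y , q , g , r =
        one-sided T (flip (z , exact r , e₀)) σ ,
        before (leg (proj₁ (proj₂ pre)) (proj₂ (proj₂ pre))) (flip (z , exact r′ , e₀))
          (subst Placed (sym (++-assoc zs (p ∷ []) (v ∷ us))) σ) ,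
        λ r≡2 → let d , d′ = after (leg (~-sym e₀) (proj₁ (proj₂ rev))) T (retrunk τ σ) r≡2 in
          d , d′ , unlit T (proj₁ (step r)) r′ σ r≡2
        where
        T : Link s zs p
        T = y , exact q , g
        -- The trunk up to and including `p` serves as a leg at `s`; the part after `p`, reversed in
        -- `rev`, serves as a leg at `t`.
        pre = prefix-leg zs q g
        r′  = proj₂ (step r)
        rev = reverse (exact r′)
        τ : proj₁ rev ++ p ∷ zs ↭ zs ++ p ∷ v ∷ us
        τ = ↭-trans (Perm.++-comm (proj₁ rev) (p ∷ zs))
              (↭-trans (↭-sym (Perm.shift p zs (proj₁ rev))) (Perm.++⁺ˡ zs (prep p (proj₂ (proj₂ rev)))))

      conclude : ∀ P′ → P ≡ P′ → Suffixes Gap P → total lit P ≤ length P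
      conclude []       refl _  = z≤n
      conclude (p ∷ us) refl gs = begin
        total lit P                      ≡⟨ ℕ.+-identityʳ _ ⟨
        total lit P + 0                  ≤⟨ gaps gs (inj₁ refl) ⟩
        length P + (l p ∸ 1)
          ≡⟨ cong (λ k → length P + (k ∸ 1)) (sum-zero (adj? G (leaf L₁) p) (adj? G (leaf L₂) p)
               (first-nonadjacent L₁ L₂ L₃ L₄ T σ) (first-nonadjacent L₂ L₁ L₃ L₄ T (swapˢ σ))) ⟩
        length P + 0                     ≡⟨ ℕ.+-identityʳ _ ⟩
        length P                         ∎
        where
        open ℕ.≤-Reasoning
        T : Link t us p
        T = flip (z , exact (proj₂ (step q₀)) , e₀)

    -- No leaf is adjacent to the opposite hub, and an edge to its own hub is counted with its leg.
    -- The two hubs are left over, hence the 2.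
    two-hub-bound : (L₁ L₂ : Leg s) (L₃ L₄ : Leg t) → Path s (s ∷ P) w → w ~ t → k ≡ length P →
      Spans² V s t P (body L₁) (body L₂) (body L₃) (body L₄) →
      2 + total (λ u → χ (leaf L₁) u + χ (leaf L₂) u + χ (leaf L₃) u + χ (leaf L₄) u) V ≤ length V
    two-hub-bound {s} {t} {P} L₁ L₂ L₃ L₄ q₀ e₀ k≡ σ = begin
      2 + total wt V
        ≡⟨ cong (2 +_) (total-↭ wt (↭-sym (arrangement² σ))) ⟩
      2 + (wt s + (wt t + total wt (P ++ A₁ ++ A₂ ++ A₃ ++ A₄)))
        ≡⟨ cong (λ k → 2 + (wt s + (wt t + k))) 
             (trans (total-++ wt P _) (cong (total wt P +_) (total-++₄ wt A₁ A₂ A₃ A₄))) ⟩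
      2 + (wt s + (wt t + (total wt P + (total wt A₁ + (total wt A₂ + (total wt A₃ + total wt A₄))))))
        ≡⟨ cong₂ (λ i j → 2 + (i + (j + (total wt P + (total wt A₁ + (total wt A₂ + (total wt A₃ + total wt A₄)))))))
             at-s at-t ⟩
      2 + ((d₁ + d₂) + ((d₃ + d₄) + (total wt P + (total wt A₁ + (total wt A₂ + (total wt A₃ + total wt A₄))))))
        ≡⟨ cong (λ k → 2 + ((d₁ + d₂) + ((d₃ + d₄) + k)))
             (cong₂ _+_ (total-cong (λ u → lemma₀ (e₁ u) (e₂ u) (e₃ u) (e₄ u)) P)
             (cong₂ _+_ (total-cong (λ u → lemma₁ (e₁ u) (e₂ u) (e₃ u) (e₄ u)) A₁)
             (cong₂ _+_ (total-cong (λ u → lemma₂ (e₁ u) (e₂ u) (e₃ u) (e₄ u)) A₂)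
             (cong₂ _+_ (total-cong (λ u → lemma₃ (e₁ u) (e₂ u) (e₃ u) (e₄ u)) A₃)
                        (total-cong (λ u → lemma₄ (e₁ u) (e₂ u) (e₃ u) (e₄ u)) A₄))))) ⟩
      2 + ((d₁ + d₂) + ((d₃ + d₄) + (total _ P + (total _ A₁ + (total _ A₂ + (total _ A₃ + total _ A₄))))))
        ≡⟨ lemma d₁ d₂ d₃ d₄ (total _ P) (total _ A₁) (total _ A₂) (total _ A₃) (total _ A₄) ⟩
      2 + (total _ P + ((total _ A₁ + d₁) + ((total _ A₂ + d₂) + ((total _ A₃ + d₃) + (total _ A₄ + d₄)))))
        ≤⟨ ℕ.+-monoʳ-≤ 2 (ℕ.+-mono-≤ (trunk-bound L₁ L₂ L₃ L₄ q₀ e₀ σ)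
             (ℕ.+-mono-≤ (leg-bound L₃ L₄ L₁ L₂ (flip T) k≡ (turn σ))
             (ℕ.+-mono-≤ (leg-bound L₃ L₄ L₂ L₁ (flip T) k≡ (turn (swapˢ σ)))
             (ℕ.+-mono-≤ (leg-bound L₁ L₂ L₃ L₄ T k≡ σ) (leg-bound L₁ L₂ L₄ L₃ T k≡ (swapᵗ σ)))))) ⟩
      2 + (length P + (length A₁ + (length A₂ + (length A₃ + length A₄))))
        ≡⟨ cong (2 +_) (trans (length-++ P) (cong (length P +_) (length-++₄ A₁ A₂ A₃ A₄))) ⟨
      length (s ∷ t ∷ P ++ A₁ ++ A₂ ++ A₃ ++ A₄)
        ≡⟨ Perm.↭-length (arrangement² σ) ⟩
      length V ∎
      where
      open ℕ.≤-Reasoning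
      T : Link s P t
      T = _ , exact q₀ , e₀
      A₁ = body L₁
      A₂ = body L₂
      A₃ = body L₃
      A₄ = body L₄
      d₁ = χ (leaf L₁) s
      d₂ = χ (leaf L₂) s
      d₃ = χ (leaf L₃) t
      d₄ = χ (leaf L₄) t
      e₁ e₂ e₃ e₄ wt : Fin n → ℕ
      e₁ = χ (leaf L₁)
      e₂ = χ (leaf L₂)
      e₃ = χ (leaf L₃)
      e₄ = χ (leaf L₄)
      wt u = e₁ u + e₂ u + e₃ u + e₄ u
      at-s : wt s ≡ d₁ + d₂
      at-s rewrite ⟦⟧≡0 (adj? G (leaf L₃) s) (leaf-≁-far-hub L₃ L₄ L₁ L₂ (flip T) (turn σ))
                 | ⟦⟧≡0 (adj? G (leaf L₄) s) (leaf-≁-far-hub L₄ L₃ L₁ L₂ (flip T) (turn (swapᵗ σ))) =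
        trans (ℕ.+-identityʳ _) (ℕ.+-identityʳ _)
      at-t : wt t ≡ d₃ + d₄
      at-t rewrite ⟦⟧≡0 (adj? G (leaf L₁) t) (leaf-≁-far-hub L₁ L₂ L₃ L₄ T σ)
                 | ⟦⟧≡0 (adj? G (leaf L₂) t) (leaf-≁-far-hub L₂ L₁ L₃ L₄ T (swapˢ σ)) = refl
      lemma₀ : ∀ a b c d → a + b + c + d ≡ (a + b) + (c + d)
      lemma₀ = solve-∀
      lemma₁ : ∀ a b c d → a + b + c + d ≡ (c + d + b) + a
      lemma₁ = solve-∀
      lemma₂ : ∀ a b c d → a + b + c + d ≡ (c + d + a) + b
      lemma₂ = solve-∀
      lemma₃ : ∀ a b c d → a + b + c + d ≡ (a + b + d) + c
      lemma₃ = solve-∀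
      lemma₄ : ∀ a b c d → a + b + c + d ≡ (a + b + c) + d
      lemma₄ = solve-∀
      lemma : ∀ a b c d p t₁ t₂ t₃ t₄ → 2 + ((a + b) + ((c + d) + (p + (t₁ + (t₂ + (t₃ + t₄)))))) ≡
                                        2 + (p + ((t₁ + a) + ((t₂ + b) + ((t₃ + c) + (t₄ + d)))))
      lemma = solve-∀

-- The extremal tree

module Extremal {n : ℕ} (G : Graph n) where
  open Paths G
  open Legs G
  open Trunks G

  private
    variable
      c s t v w x : Fin n
      V P l₁ l₂ l₃ l₄ : List (Fin n)

  -- Legs may be empty, so even a single vertex is a spider.
  data SpiderOn (V : List (Fin n)) : Set where
    spider : ∀ {c l₁ l₂ l₃ l₄ x₁ x₂ x₃ x₄} →
      c ⟨ c ∷ l₁ ⟩ x₁ → c ⟨ c ∷ l₂ ⟩ x₂ → c ⟨ c ∷ l₃ ⟩ x₃ → c ⟨ c ∷ l₄ ⟩ x₄ →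
      c ∷ l₁ ++ l₂ ++ l₃ ++ l₄ ↭ V → SpiderOn V

  data TwoHubsOn (V P : List (Fin n)) : Set where
    two-hubs : ∀ {s t l₁ l₂ l₃ l₄ x₁ x₂ x₃ x₄} → Link s P t →
      s ⟨ s ∷ l₁ ⟩ x₁ → s ⟨ s ∷ l₂ ⟩ x₂ → t ⟨ t ∷ l₃ ⟩ x₃ → t ⟨ t ∷ l₄ ⟩ x₄ →
      s ∷ t ∷ P ++ l₁ ++ l₂ ++ l₃ ++ l₄ ↭ V → TwoHubsOn V P

  star-free : K₁, 5 -Free G → ∀ {u y₁ y₂ y₃ y₄ y₅} → let ys = y₁ ∷ y₂ ∷ y₃ ∷ y₄ ∷ y₅ ∷ [] in
    Unique ys → All (u ~_) ys → ¬ AllPairs (λ x y → ¬ x ~ y) ys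
  star-free free {u} {y₁} {y₂} {y₃} {y₄} {y₅} un adj non = free (f , (λ {i} {j} → inj i j) , iff)
    where
    ys = y₁ ∷ y₂ ∷ y₃ ∷ y₄ ∷ y₅ ∷ []
    f : Fin 6 → Fin n
    f zero    = u
    f (suc i) = lookup ys i
    u~ : ∀ i → u ~ lookup ys i
    u~ i = All.lookup adj (∈-lookup i)
    inj : ∀ i j → f i ≡ f j → i ≡ j
    inj zero    zero    _  = refl
    inj zero    (suc j) eq = ⊥-elim (Graph.irrefl G eq (u~ j))
    inj (suc i) zero    eq = ⊥-elim (Graph.irrefl G (sym eq) (u~ i))
    inj (suc i) (suc j) eq = cong suc (lookup-injective un i j eq)
    non′ : ∀ i j → ¬ lookup ys i ~ lookup ys j
    non′ i j e with AllPairs-lookup non (∈-lookup {xs = ys} i) (∈-lookup {xs = ys} j)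
    ... | inj₁ eq        = Graph.irrefl G eq e
    ... | inj₂ (inj₁ ¬e) = ¬e e
    ... | inj₂ (inj₂ ¬e) = ¬e (~-sym e)
    iff : ∀ i j → _
    iff zero    zero    = mk⇔ (λ ()) (λ e → ⊥-elim (Graph.irrefl G refl e))
    iff zero    (suc j) = mk⇔ (λ _ → u~ j) _
    iff (suc i) zero    = mk⇔ (λ _ → ~-sym (u~ i)) _
    iff (suc i) (suc j) = mk⇔ (λ ()) (λ e → ⊥-elim (non′ i j e))

  _∈?_ : ∀ v V → Dec (v ∈ V)
  _∈?_ = DecMembership._∈?_ (Fin._≟_ {n})

  crossing : Star _~_ w v → w ∈ V → v ∉ V → ∃[ a ] ∃[ b ] a ∈ V × b ∉ V × a ~ b
  crossing ε a∈ b∉ = ⊥-elim (b∉ a∈)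
  crossing {V = V} (_◅_ {j = b} e p) a∈ v∉ with b ∈? V
  ... | yes b∈ = crossing p b∈ v∉
  ... | no b∉  = _ , b , a∈ , b∉ , e

  exit : (∀ u v → Star _~_ u v) → length V < n → w ∈ V → ∃[ a ] ∃[ b ] a ∈ V × b ∉ V × a ~ b
  exit {V} conn |V|<n w∈ with any? (λ v → ¬? (v ∈? V))
  ... | yes (v , v∉) = crossing (conn _ v) w∈ v∉
  ... | no all∈      = ⊥-elim (ℕ.<⇒≱ |V|<n (subst (_≤ length V) (length-tabulate {n = n} (λ i → i))
    (Unique⇒length≤ (Unique.allFin⁺ n) (λ {v} _ → decidable-stable (v ∈? V) (λ v∉ → all∈ (v , v∉))))))

  -- A vertex attached to an inner vertex of a leg turns that vertex into a second hub.
  attach-to-leg : c ⟨ c ∷ l₁ ⟩ x → ∀ {x₂ x₃} → c ⟨ c ∷ l₂ ⟩ x₂ → c ⟨ c ∷ l₃ ⟩ x₃ → c ∷ l₁ ++ l₂ ++ l₃ ↭ V →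
    w ∈ l₁ → w ~ v → ∃[ P ] TwoHubsOn (v ∷ V) P
  attach-to-leg {c} {l₁} {l₂ = l₂} {l₃} {w = w} {v} p₁ p₂ p₃ σ w∈ e with uncons p₁
  ... | inj₁ (refl , _) with () ← w∈
  ... | inj₂ (_ , f , l , p , τ) with zs , us , refl ← ∈-∃++ (Perm.∈-resp-↭ (↭-sym τ) w∈) =
    let y , q , g , r = split zs (f ∷ p) in
    zs , two-hubs (flip (y , exact q , g)) (point ⁀⟨ e ⟩ point) (exact r) p₂ p₃
      (↭-trans (solve 7 (λ c z w v d l₂ l₃ → (w ⊕ c ⊕ z ⊕ v ⊕ d ⊕ l₂ ⊕ l₃) ⊜ (v ⊕ c ⊕ (z ⊕ w ⊕ d) ⊕ l₂ ⊕ l₃)) ↭-refl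
          (c ∷ []) zs (w ∷ []) (v ∷ []) us l₂ l₃)
        (prep v (↭-trans (prep c (Perm.++⁺ʳ _ τ)) σ)))

  -- Either `w` is the centre, which gets `v` as a fourth leg, or `w` lies on a leg and becomes a
  -- hub.
  attach : ∀ {x₁ x₂ x₃} → c ⟨ c ∷ l₁ ⟩ x₁ → c ⟨ c ∷ l₂ ⟩ x₂ → c ⟨ c ∷ l₃ ⟩ x₃ → c ∷ l₁ ++ l₂ ++ l₃ ↭ V →
    w ∈ V → w ~ v → SpiderOn (v ∷ V) ⊎ ∃[ P ] TwoHubsOn (v ∷ V) P
  attach {c} {l₁} {l₂} {l₃} {w = w} {v} p₁ p₂ p₃ σ w∈ e with Perm.∈-resp-↭ (↭-sym σ) w∈
  ... | here refl = inj₁ (spider p₁ p₂ p₃ (point ⁀⟨ e ⟩ point)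
    (↭-trans (solve 5 (λ c v l₁ l₂ l₃ → (c ⊕ l₁ ⊕ l₂ ⊕ l₃ ⊕ v) ⊜ (v ⊕ c ⊕ l₁ ⊕ l₂ ⊕ l₃)) ↭-refl
      (c ∷ []) (v ∷ []) l₁ l₂ l₃) (prep v σ)))
  ... | there w∈′ with ∈-++⁻ l₁ w∈′
  ...   | inj₁ w∈₁ = inj₂ (attach-to-leg p₁ p₂ p₃ σ w∈₁ e)
  ...   | inj₂ w∈″ with ∈-++⁻ l₂ w∈″
  ...     | inj₁ w∈₂ = inj₂ (attach-to-leg p₂ p₁ p₃ (↭-trans (prep c (Perm.shifts l₂ l₁)) σ) w∈₂ e)
  ...     | inj₂ w∈₃ = inj₂ (attach-to-leg p₃ p₁ p₂ (↭-trans (solve 4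
    (λ c l₁ l₂ l₃ → (c ⊕ l₃ ⊕ l₁ ⊕ l₂) ⊜ (c ⊕ l₁ ⊕ l₂ ⊕ l₃)) ↭-refl (c ∷ []) l₁ l₂ l₃) σ) w∈₃ e)

  to-leg : c ⟨ c ∷ l₁ ⟩ x → l₁ ≡ [] ⊎ (∃[ L ] body {c} L ↭ l₁)
  to-leg p with uncons p
  ... | inj₁ (eq , _)              = inj₁ eq
  ... | inj₂ (_ , e , _ , q , τ)   = inj₂ (leg e q , τ)

  module _ (conn : Connected G) (free : K₁, 5 -Free G) (bound : [ n ∸ 1 ] ≤⁺ σ 4 G) where

    -- All neighbours of the four vertices lie in `V`, so the sum is an upper bound for their degree
    -- sum, against the hypothesis on `σ 4 G`. The permutation supplies distinctness.
    too-few-neighbours : Unique V → ∀ {x₁ x₂ x₃ x₄ l} → x₁ ∷ x₂ ∷ x₃ ∷ x₄ ∷ l ↭ V →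
      AllPairs (λ x y → ¬ x ~ y) (x₁ ∷ x₂ ∷ x₃ ∷ x₄ ∷ []) →
      (∀ {v} → v ∉ V → ¬ x₁ ~ v × ¬ x₂ ~ v × ¬ x₃ ~ v × ¬ x₄ ~ v) →
      ¬ (total (λ u → χ x₁ u + χ x₂ u + χ x₃ u + χ x₄ u) V < n ∸ 1)
    too-few-neighbours {V} un {x₁} {x₂} {x₃} {x₄} τ non closed small = ℕ.<⇒≱ small (begin
      n ∸ 1
        ≤⟨ σ-lower-bound G bound (Unique-++⁻ˡ (x₁ ∷ x₂ ∷ x₃ ∷ x₄ ∷ []) (Unique-resp-↭ (↭-sym τ) un)) non ⟩
      degree G x₁ + (degree G x₂ + (degree G x₃ + (degree G x₄ + 0)))
        ≤⟨ ℕ.+-mono-≤ (deg (proj₁ ∘ closed)) (ℕ.+-mono-≤ (deg (proj₁ ∘ proj₂ ∘ closed))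
             (ℕ.+-mono-≤ (deg (proj₁ ∘ proj₂ ∘ proj₂ ∘ closed))
             (ℕ.+-mono-≤ (deg (proj₂ ∘ proj₂ ∘ proj₂ ∘ closed)) z≤n))) ⟩
      total (χ x₁) V + (total (χ x₂) V + (total (χ x₃) V + (total (χ x₄) V + 0)))
        ≡⟨ total-+₄ (χ x₁) (χ x₂) (χ x₃) (χ x₄) V ⟨
      total (λ u → χ x₁ u + χ x₂ u + χ x₃ u + χ x₄ u) V ∎)
      where
      open ℕ.≤-Reasoning
      deg : (∀ {v} → v ∉ V → ¬ x ~ v) → degree G x ≤ total (χ x) V
      deg {x} out = ∣tabulate∣≤total (adj? G x) (λ {v} e → decidable-stable (v ∈? V) (λ v∉ → out v∉ e))

    module _ (un : Unique V) (maximal : ∀ {v} → v ∉ V → ¬ SpiderOn (v ∷ V) × ¬ (∃[ P ] TwoHubsOn (v ∷ V) P)) where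

      no-star : ∀ {u y₁ y₂ y₃ y₄ y₅ l} → y₁ ∷ y₂ ∷ y₃ ∷ y₄ ∷ y₅ ∷ l ↭ V →
                All (u ~_) (y₁ ∷ y₂ ∷ y₃ ∷ y₄ ∷ y₅ ∷ []) →
                ¬ AllPairs (λ x y → ¬ x ~ y) (y₁ ∷ y₂ ∷ y₃ ∷ y₄ ∷ y₅ ∷ [])
      no-star {y₁ = y₁} {y₂} {y₃} {y₄} {y₅} τ =
        star-free free (Unique-++⁻ˡ (y₁ ∷ y₂ ∷ y₃ ∷ y₄ ∷ y₅ ∷ []) (Unique-resp-↭ (↭-sym τ) un))

      module _ (|V|<n : length V < n) where

        no-tripod : ∀ {c l₁ l₂ l₃ x₁ x₂ x₃} → c ⟨ c ∷ l₁ ⟩ x₁ → c ⟨ c ∷ l₂ ⟩ x₂ → c ⟨ c ∷ l₃ ⟩ x₃ →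
                    ¬ (c ∷ l₁ ++ l₂ ++ l₃ ↭ V)
        no-tripod {c} p₁ p₂ p₃ σ =
          let _ , _ , w∈ , v∉ , e = exit {V} {c} (proj₂ conn) |V|<n (Perm.∈-resp-↭ σ (here refl))
          in [ proj₁ (maximal v∉) , proj₂ (maximal v∉) ]′ (attach p₁ p₂ p₃ σ w∈ e)

        open MaximalSpider G V

        no-proper-legs : (L₁ L₂ L₃ L₄ : Leg c) → ¬ Spans V c (body L₁) (body L₂) (body L₃) (body L₄)
        no-proper-legs {c} L₁ L₂ L₃ L₄ σ =
          let l₁ , τ₁ = last-out (path L₁)
              l₂ , τ₂ = last-out (path L₂)
              l₃ , τ₃ = last-out (path L₃)
              l₄ , τ₄ = last-out (path L₄)
          in too-few-neighbours un
          (↭-trans (↭-trans (solve 9 (λ c x₁ x₂ x₃ x₄ l₁ l₂ l₃ l₄ →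
              (x₁ ⊕ x₂ ⊕ x₃ ⊕ x₄ ⊕ c ⊕ l₁ ⊕ l₂ ⊕ l₃ ⊕ l₄) ⊜ (c ⊕ (x₁ ⊕ l₁) ⊕ (x₂ ⊕ l₂) ⊕ (x₃ ⊕ l₃) ⊕ x₄ ⊕ l₄)) ↭-refl
              (c ∷ []) (leaf L₁ ∷ []) (leaf L₂ ∷ []) (leaf L₃ ∷ []) (leaf L₄ ∷ []) l₁ l₂ l₃ l₄)
            (prep c (Perm.++⁺ τ₁ (Perm.++⁺ τ₂ (Perm.++⁺ τ₃ τ₄))))) (arrangement σ))
          (( non L₁ L₂ L₃ L₄ σ ∷ non L₁ L₃ L₂ L₄ (swap₂₃ σ) ∷ non L₁ L₄ L₂ L₃ (swap₂₃ (swap₃₄ σ)) ∷ [])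
          ∷ ( non L₂ L₃ L₁ L₄ (swap₂₃ (swap₁₂ σ)) ∷ non L₂ L₄ L₁ L₃ (swap₂₃ (swap₁₂ (swap₃₄ σ))) ∷ [])
          ∷ ( non L₃ L₄ L₁ L₂ (swap₂₃ (swap₁₂ (swap₃₄ (swap₂₃ σ)))) ∷ [])
          ∷ [] ∷ [])
          (λ v∉ → out L₁ L₂ L₃ L₄ σ v∉ , out L₂ L₁ L₃ L₄ (swap₁₂ σ) v∉ ,
                  out L₃ L₁ L₂ L₄ (swap₁₂ (swap₂₃ σ)) v∉ , out L₄ L₁ L₂ L₃ (swap₁₂ (swap₂₃ (swap₃₄ σ))) v∉)
          -- A vertex is missing from `V`, so `length V` is at most `n ∸ 1`, and `spider-bound` is
          -- strict.
          (ℕ.<-≤-trans (spider-bound no-tripod no-star L₁ L₂ L₃ L₄ σ) (ℕ.∸-monoˡ-≤ 1 |V|<n))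
          where
          non : (L₁ L₂ L₃ L₄ : Leg c) → Spans V c (body L₁) (body L₂) (body L₃) (body L₄) → ¬ leaf L₁ ~ leaf L₂
          non = leaves-nonadjacent no-tripod no-star
          out : (L₁ L₂ L₃ L₄ : Leg c) → Spans V c (body L₁) (body L₂) (body L₃) (body L₄) →
            ∀ {v} → v ∉ V → ¬ leaf L₁ ~ v
          out L₁ L₂ L₃ L₄ σ {v} v∉ e = proj₁ (maximal v∉) (spider (full L₁ ⁀⟨ e ⟩ point) (full L₂) (full L₃) (full L₄)
            (↭-trans (solve 6 (λ c v l₁ l₂ l₃ l₄ → (c ⊕ (l₁ ⊕ v) ⊕ l₂ ⊕ l₃ ⊕ l₄) ⊜ (v ⊕ c ⊕ l₁ ⊕ l₂ ⊕ l₃ ⊕ l₄)) ↭-refl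
              (c ∷ []) (v ∷ []) (body L₁) (body L₂) (body L₃) (body L₄)) (prep v (arrangement σ))))

        no-proper-spider : ¬ SpiderOn V
        no-proper-spider (spider {c} {l₁} {l₂} {l₃} {l₄} p₁ p₂ p₃ p₄ σ)
          with to-leg p₁ | to-leg p₂ | to-leg p₃ | to-leg p₄
        ... | inj₁ refl | _ | _ | _ = no-tripod p₂ p₃ p₄ σ
        ... | _ | inj₁ refl | _ | _ = no-tripod p₁ p₃ p₄ σ
        ... | _ | _ | inj₁ refl | _ = no-tripod p₁ p₂ p₄ σ
        ... | _ | _ | _ | inj₁ refl = no-tripod p₁ p₂ p₃ (↭-trans (solve 4
          (λ c l₁ l₂ l₃ → (c ⊕ l₁ ⊕ l₂ ⊕ l₃) ⊜ (c ⊕ l₁ ⊕ l₂ ⊕ l₃ ⊕ id)) ↭-refl (c ∷ []) l₁ l₂ l₃) σ)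
        ... | inj₂ (L₁ , τ₁) | inj₂ (L₂ , τ₂) | inj₂ (L₃ , τ₃) | inj₂ (L₄ , τ₄) =
          no-proper-legs L₁ L₂ L₃ L₄ (spans (↭-trans (prep c (Perm.++⁺ τ₁ (Perm.++⁺ τ₂ (Perm.++⁺ τ₃ τ₄)))) σ))

      module _ (no-spider : ¬ SpiderOn V) where

        -- A hub with an empty leg is an ordinary path vertex, and the tree is a spider centred at
        -- the other hub.
        no-short-leg : Link s P t → ∀ {x₂ x₃ x₄} → s ⟨ s ∷ l₂ ⟩ x₂ → t ⟨ t ∷ l₃ ⟩ x₃ → t ⟨ t ∷ l₄ ⟩ x₄ →
          ¬ Spans² V s t P [] l₂ l₃ l₄
        no-short-leg {s} {P} {t} {l₂} {l₃} {l₄} T p₂ p₃ p₄ σ =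
          let _ , q , f = flip T in
          no-spider (spider p₃ p₄ (q ⁀⟨ f ⟩ p₂) point
            (↭-trans (solve 6 (λ s t p l₂ l₃ l₄ → (t ⊕ l₃ ⊕ l₄ ⊕ (p ⊕ s ⊕ l₂) ⊕ id) ⊜ (s ⊕ t ⊕ p ⊕ l₂ ⊕ l₃ ⊕ l₄)) ↭-refl
              (s ∷ []) (t ∷ []) P l₂ l₃ l₄) (arrangement² σ)))

        -- Recovers the actual order of the trunk, which `Link` forgets and `trunk-bound` needs.
        straighten : Link s P t → ∃[ P′ ] ∃[ w ] Path s (s ∷ P′) w × w ~ t × P′ ↭ P
        straighten (_ , (_ , [-]   , τ) , e) = _ , _ , [-]   , e , Perm.drop-∷ τ
        straighten (_ , (_ , g ∷ p , τ) , e) = _ , _ , g ∷ p , e , Perm.drop-∷ τ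

        no-hubs-with-legs : (L₁ L₂ : Leg s) (L₃ L₄ : Leg t) → Link s P t →
          (∀ {Q} → length P < length Q → ¬ TwoHubsOn V Q) →
          ¬ Spans² V s t P (body L₁) (body L₂) (body L₃) (body L₄)
        no-hubs-with-legs {s} {t} {P} L₁ L₂ L₃ L₄ T no-longer σ =
          let l₁ , τ₁ = last-out (path L₁)
              l₂ , τ₂ = last-out (path L₂)
              l₃ , τ₃ = last-out (path L₃)
              l₄ , τ₄ = last-out (path L₄)
              P′ , _ , q , e , τ = straighten T
          in too-few-neighbours un
          (↭-trans (↭-trans (solve 11 (λ s t p x₁ x₂ x₃ x₄ l₁ l₂ l₃ l₄ →
              (x₁ ⊕ x₂ ⊕ x₃ ⊕ x₄ ⊕ s ⊕ t ⊕ p ⊕ l₁ ⊕ l₂ ⊕ l₃ ⊕ l₄)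
                ⊜ (s ⊕ t ⊕ p ⊕ (x₁ ⊕ l₁) ⊕ (x₂ ⊕ l₂) ⊕ (x₃ ⊕ l₃) ⊕ x₄ ⊕ l₄)) ↭-refl
              (s ∷ []) (t ∷ []) P (leaf L₁ ∷ []) (leaf L₂ ∷ []) (leaf L₃ ∷ []) (leaf L₄ ∷ []) l₁ l₂ l₃ l₄)
            (prep s (prep t (Perm.++⁺ˡ P (Perm.++⁺ τ₁ (Perm.++⁺ τ₂ (Perm.++⁺ τ₃ τ₄))))))) (arrangement² σ))
          (( same-side-nonadjacent ns nl L₁ L₂ L₃ L₄ T σ
           ∷ opposite-nonadjacent ns nl L₁ L₂ L₃ L₄ T σ
           ∷ opposite-nonadjacent ns nl L₁ L₂ L₄ L₃ T (swapᵗ σ) ∷ [])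
          ∷ ( opposite-nonadjacent ns nl L₂ L₁ L₃ L₄ T (swapˢ σ)
           ∷ opposite-nonadjacent ns nl L₂ L₁ L₄ L₃ T (swapᵗ (swapˢ σ)) ∷ [])
          ∷ ( same-side-nonadjacent ns nl L₃ L₄ L₁ L₂ (flip T) (turn σ) ∷ [])
          ∷ [] ∷ [])
          (λ v∉ → out L₁ L₂ L₃ L₄ T σ v∉ , out L₂ L₁ L₃ L₄ T (swapˢ σ) v∉ ,
                  out L₃ L₄ L₁ L₂ (flip T) (turn σ) v∉ , out L₄ L₃ L₁ L₂ (flip T) (swapˢ (turn σ)) v∉)
          -- Here `V` may contain all vertices; the two units of `two-hub-bound` alone yield the
          -- strict inequality.
          (ℕ.≤-trans (ℕ.∸-monoˡ-≤ 1 (two-hub-bound ns nl L₁ L₂ L₃ L₄ q e (sym (Perm.↭-length τ)) (retrunk τ σ)))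
                     (ℕ.∸-monoˡ-≤ 1 (Unique⇒length≤n un)))
          where
          open LongestTrunk G V (length P)
          ns : ∀ {c l₁ l₂ l₃ l₄ x₁ x₂ x₃ x₄} →
               c ⟨ c ∷ l₁ ⟩ x₁ → c ⟨ c ∷ l₂ ⟩ x₂ → c ⟨ c ∷ l₃ ⟩ x₃ → c ⟨ c ∷ l₄ ⟩ x₄ →
               ¬ (c ∷ l₁ ++ l₂ ++ l₃ ++ l₄ ↭ V)
          ns p₁ p₂ p₃ p₄ σ = no-spider (spider p₁ p₂ p₃ p₄ σ)
          nl : ∀ {s t Q l₁ l₂ l₃ l₄ x₁ x₂ x₃ x₄} → Link s Q t →
               s ⟨ s ∷ l₁ ⟩ x₁ → s ⟨ s ∷ l₂ ⟩ x₂ → t ⟨ t ∷ l₃ ⟩ x₃ → t ⟨ t ∷ l₄ ⟩ x₄ →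
               length P < length Q → ¬ (s ∷ t ∷ Q ++ l₁ ++ l₂ ++ l₃ ++ l₄ ↭ V)
          nl T p₁ p₂ p₃ p₄ longer σ = no-longer longer (two-hubs T p₁ p₂ p₃ p₄ σ)
          out : ∀ {s t} (L₁ L₂ : Leg s) (L₃ L₄ : Leg t) → Link s P t →
            Spans² V s t P (body L₁) (body L₂) (body L₃) (body L₄) → ∀ {v} → v ∉ V → ¬ leaf L₁ ~ v
          out {s} {t} L₁ L₂ L₃ L₄ T σ {v} v∉ e = proj₂ (maximal v∉) (P , two-hubs T
            (full L₁ ⁀⟨ e ⟩ point) (full L₂) (full L₃) (full L₄)
            (↭-trans (solve 8 (λ s t p v l₁ l₂ l₃ l₄ →
                (s ⊕ t ⊕ p ⊕ (l₁ ⊕ v) ⊕ l₂ ⊕ l₃ ⊕ l₄) ⊜ (v ⊕ s ⊕ t ⊕ p ⊕ l₁ ⊕ l₂ ⊕ l₃ ⊕ l₄)) ↭-refl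
              (s ∷ []) (t ∷ []) P (v ∷ []) (body L₁) (body L₂) (body L₃) (body L₄)) (prep v (arrangement² σ))))

        -- Induction on `j`, a bound for the growth still possible for the trunk: the induction
        -- hypothesis excludes longer trunks, so `P` can be treated as a longest one.
        no-hubs : ∀ j {P} → length V ≤ length P + j → ¬ TwoHubsOn V P
        no-hubs zero {P} V≤P (two-hubs {s} {t} {l₁} _ _ _ _ _ σ) = ℕ.<-irrefl refl (begin-strict
          length P                     <⟨ ℕ.n<1+n _ ⟩
          suc (length P)               ≤⟨ ℕ.n≤1+n _ ⟩
          2 + length P                 ≤⟨ ℕ.+-monoʳ-≤ 2 (ℕ.≤-trans (ℕ.m≤m+n _ _) (ℕ.≤-reflexive (sym (length-++ P)))) ⟩
          _                            ≡⟨ Perm.↭-length σ ⟩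
          length V                     ≤⟨ V≤P ⟩
          length P + 0                 ≡⟨ ℕ.+-identityʳ _ ⟩
          length P                     ∎)
          where open ℕ.≤-Reasoning
        no-hubs (suc j) {P} V≤P (two-hubs T p₁ p₂ p₃ p₄ σ) with to-leg p₁ | to-leg p₂ | to-leg p₃ | to-leg p₄
        ... | inj₁ refl | _ | _ | _ = no-short-leg T p₂ p₃ p₄ (spans² σ)
        ... | _ | inj₁ refl | _ | _ = no-short-leg T p₁ p₃ p₄ (swapˢ (spans² σ))
        ... | _ | _ | inj₁ refl | _ = no-short-leg (flip T) p₄ p₁ p₂ (turn (spans² σ))
        ... | _ | _ | _ | inj₁ refl = no-short-leg (flip T) p₃ p₁ p₂ (swapˢ (turn (spans² σ)))
        ... | inj₂ (L₁ , τ₁) | inj₂ (L₂ , τ₂) | inj₂ (L₃ , τ₃) | inj₂ (L₄ , τ₄) =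
          no-hubs-with-legs L₁ L₂ L₃ L₄ T
            (λ P<Q → no-hubs j (ℕ.≤-trans V≤P (ℕ.≤-trans (ℕ.≤-reflexive (ℕ.+-suc (length P) j)) (ℕ.+-monoˡ-≤ j P<Q))))
            (spans² (↭-trans (prep _ (prep _ (Perm.++⁺ˡ P (Perm.++⁺ τ₁ (Perm.++⁺ τ₂ (Perm.++⁺ τ₃ τ₄)))))) σ))

    module _ (none : ∀ {V} → Unique V → length V ≡ n → ¬ SpiderOn V) where

      -- Induction on the number `k` of vertices outside `V` replaces the choice of a largest tree:
      -- the induction hypothesis for `v ∷ V` is the maximality of `V`.
      no-tree : ∀ k {V} → Unique V → length V + k ≡ n → ¬ SpiderOn V × ¬ (∃[ P ] TwoHubsOn V P)
      no-tree k {V} un eq = absent k eq , λ (P , H) →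
        no-hubs un (larger k eq) (absent k eq) (length V) (ℕ.m≤n+m _ (length P)) H
        where
        larger : ∀ k → length V + k ≡ n → ∀ {v} → v ∉ V → ¬ SpiderOn (v ∷ V) × ¬ (∃[ P ] TwoHubsOn (v ∷ V) P)
        larger zero    eq v∉ = ⊥-elim (ℕ.<⇒≱ (ℕ.≤-reflexive (cong suc (trans (sym eq) (ℕ.+-identityʳ _))))
          (Unique⇒length≤n (¬Any⇒All¬ V v∉ ∷ un)))
        larger (suc k) eq v∉ = no-tree k (¬Any⇒All¬ V v∉ ∷ un) (trans (sym (ℕ.+-suc (length V) k)) eq)

        absent : ∀ k → length V + k ≡ n → ¬ SpiderOn V
        absent zero    eq = none un (trans (sym (ℕ.+-identityʳ _)) eq)
        absent (suc k) eq = no-proper-spider un (larger (suc k) eq)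
          (ℕ.≤-trans (ℕ.m≤m+n (suc (length V)) k) (ℕ.≤-reflexive (trans (sym (ℕ.+-suc (length V) k)) eq)))

      no-spider-absurd : ⊥
      no-spider-absurd = proj₁
        (no-tree (n ∸ 1) ([] ∷ []) (ℕ.m+[n∸m]≡n (1≤n (proj₁ conn))))
        (spider {c = proj₁ conn} point point point point ↭-refl)
        where
        1≤n : ∀ {m} → Fin m → 1 ≤ m
        1≤n zero    = s≤s z≤n
        1≤n (suc _) = s≤s z≤n

-- Trees grown leaf by leaf

module _ {n : ℕ} where

  Edges : Set
  Edges = List (Fin n × Fin n)

  private
    variable
      c p u v x y : Fin n
      E : Edges

  verts : Fin n → Edges → List (Fin n)
  verts c []            = c ∷ []
  verts c ((_ , x) ∷ E) = x ∷ verts c E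

  nbrs : Fin n → Edges → List (Fin n)
  nbrs v []            = []
  nbrs v ((p , x) ∷ E) with v Fin.≟ p | v Fin.≟ x
  ... | yes _ | _     = x ∷ nbrs v E
  ... | no _  | yes _ = p ∷ nbrs v E
  ... | no _  | no _  = nbrs v E

  -- The edge at the head of the list is the one added last.
  data Grown (G : Graph n) (c : Fin n) : Edges → Set where
    root : Grown G c []
    grow : Grown G c E → p ∈ verts c E → x ∉ verts c E → Adj G p x → Grown G c ((p , x) ∷ E)

  nbrs-fst : ∀ p x E → x ∈ nbrs p ((p , x) ∷ E)
  nbrs-fst p x E with p Fin.≟ p
  ... | yes _ = here refl
  ... | no ¬p = ⊥-elim (¬p refl)

  nbrs-snd : ∀ p x E → p ≢ x → p ∈ nbrs x ((p , x) ∷ E)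
  nbrs-snd p x E p≢x with x Fin.≟ p | x Fin.≟ x
  ... | yes eq | _     = ⊥-elim (p≢x (sym eq))
  ... | no _   | yes _ = here refl
  ... | no _   | no ¬p = ⊥-elim (¬p refl)

  nbrs-weaken : ∀ v p x E → y ∈ nbrs v E → y ∈ nbrs v ((p , x) ∷ E)
  nbrs-weaken v p x E y∈ with v Fin.≟ p | v Fin.≟ x
  ... | yes _ | _     = there y∈
  ... | no _  | yes _ = there y∈
  ... | no _  | no _  = y∈

  nbrs⁻ : ∀ v p x E → y ∈ nbrs v ((p , x) ∷ E) → (v ≡ p × y ≡ x) ⊎ (v ≡ x × y ≡ p) ⊎ y ∈ nbrs v E
  nbrs⁻ v p x E y∈ with v Fin.≟ p | v Fin.≟ x
  nbrs⁻ v p x E (here refl) | yes refl | _        = inj₁ (refl , refl)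
  nbrs⁻ v p x E (there y∈)  | yes _    | _        = inj₂ (inj₂ y∈)
  nbrs⁻ v p x E (here refl) | no _     | yes refl = inj₂ (inj₁ (refl , refl))
  nbrs⁻ v p x E (there y∈)  | no _     | yes _    = inj₂ (inj₂ y∈)
  nbrs⁻ v p x E y∈          | no _     | no _     = inj₂ (inj₂ y∈)

  module _ {G : Graph n} where

    nbrs-⊆ : Grown G c E → y ∈ nbrs v E → v ∈ verts c E × y ∈ verts c E
    nbrs-⊆ {E = (p , x) ∷ E} {v = v} (grow g p∈ x∉ _) y∈ with nbrs⁻ v p x E y∈
    ... | inj₁ (refl , refl)        = there p∈ , here refl
    ... | inj₂ (inj₁ (refl , refl)) = here refl , there p∈
    ... | inj₂ (inj₂ y∈′)           = let a , b = nbrs-⊆ g y∈′ in there a , there b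

    nbrs-sym : Grown G c E → y ∈ nbrs v E → v ∈ nbrs y E
    nbrs-sym {E = (p , x) ∷ E} {v = v} (grow g p∈ x∉ _) y∈ with nbrs⁻ v p x E y∈
    ... | inj₁ (refl , refl)        = nbrs-snd p x E (λ eq → x∉ (subst (_∈ _) eq p∈))
    ... | inj₂ (inj₁ (refl , refl)) = nbrs-fst p x E
    ... | inj₂ (inj₂ y∈′)           = nbrs-weaken _ p x E (nbrs-sym g y∈′)

    nbrs-adjacent : Grown G c E → y ∈ nbrs v E → Adj G v y
    nbrs-adjacent {E = (p , x) ∷ E} {v = v} (grow g p∈ x∉ e) y∈ with nbrs⁻ v p x E y∈
    ... | inj₁ (refl , refl)        = e
    ... | inj₂ (inj₁ (refl , refl)) = Graph.sym G e
    ... | inj₂ (inj₂ y∈′)           = nbrs-adjacent g y∈′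

    nbrs-unique : Grown G c E → Unique (nbrs v E)
    nbrs-unique root = []
    nbrs-unique {E = (p , x) ∷ E} {v = v} (grow g p∈ x∉ _) with v Fin.≟ p | v Fin.≟ x
    ... | yes refl | _        = ¬Any⇒All¬ _ (x∉ ∘ proj₂ ∘ nbrs-⊆ g) ∷ nbrs-unique g
    ... | no _     | yes refl = ¬Any⇒All¬ _ (x∉ ∘ proj₁ ∘ nbrs-⊆ g) ∷ nbrs-unique g
    ... | no _     | no _     = nbrs-unique g

    joined : Grown G c E → v ∈ verts c E → Star (λ u w → w ∈ nbrs u E) c v
    joined root (here refl) = ε
    joined {E = (p , x) ∷ E} (grow g p∈ _ _) (here refl) =
      Star.map (nbrs-weaken _ p x E) (joined g p∈) ◅◅ nbrs-fst p x E ◅ ε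
    joined {E = (p , x) ∷ E} (grow g _ _ _) (there v∈) = Star.map (nbrs-weaken _ p x E) (joined g v∈)

    module _ (g₀ : Grown G c E) where

      tree : Graph n
      tree = record
        { Adj    = λ u v → v ∈ nbrs u E
        ; adj?   = λ u v → DecMembership._∈?_ (Fin._≟_ {n}) v (nbrs u E)
        ; sym    = nbrs-sym g₀
        ; irrefl = λ eq v∈ → Graph.irrefl G eq (nbrs-adjacent g₀ v∈)
        }

      degree-tree : ∀ v → degree tree v ≡ length (nbrs v E)
      degree-tree v = trans (∣tabulate∣ (adj? tree v) (λ w → w))
        (Perm.↭-length (members-↭ (adj? tree v) (nbrs-unique g₀) (λ w∈ → w∈) (λ w∈ → w∈)))

      tree-connected : (∀ v → v ∈ verts c E) → Connected tree
      tree-connected all = c , λ u v →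
        Star.reverse (nbrs-sym g₀) (joined g₀ (all u)) ◅◅ joined g₀ (all v)

    -- Of a cycle only the two distinct neighbours of each vertex are retained, a property easily
    -- passed to the tree without its last leaf.
    CycleIn : Edges → Set
    CycleIn E = ∃[ k ] ∃[ f ] Injective {A = Fin (3 + k)} {B = Fin n} _≡_ _≡_ f ×
      (∀ i → ∃[ j ] ∃[ l ] j ≢ l × f j ∈ nbrs (f i) E × f l ∈ nbrs (f i) E)

    -- The vertex `x` added last has `p` as its only neighbour, so it is not on the cycle and can be
    -- removed.
    acyclic : Grown G c E → ¬ CycleIn E
    acyclic root (_ , f , _ , two) with () ← proj₁ (proj₂ (proj₂ (proj₂ (two zero))))
    acyclic {c = c} {E = (p , x) ∷ E} (grow g p∈ x∉ _) (k , f , inj , two) with any? (λ i → f i Fin.≟ x)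
    ... | yes (i , refl) = let j , l , j≢l , fj∈ , fl∈ = two i in j≢l (inj (trans (only fj∈) (sym (only fl∈))))
      where
      only : ∀ {y} → y ∈ nbrs x ((p , x) ∷ E) → y ≡ p
      only y∈ with nbrs⁻ x p x E y∈
      ... | inj₁ (refl , _)        = ⊥-elim (x∉ p∈)
      ... | inj₂ (inj₁ (_ , eq))   = eq
      ... | inj₂ (inj₂ y∈′)        = ⊥-elim (x∉ (proj₁ (nbrs-⊆ g y∈′)))
    ... | no off = acyclic g (k , f , inj , λ i →
      let j , l , j≢l , fj∈ , fl∈ = two i in j , l , j≢l , old i j fj∈ , old i l fl∈)
      where
      old : ∀ i j → f j ∈ nbrs (f i) ((p , x) ∷ E) → f j ∈ nbrs (f i) E
      old i j fj∈ with nbrs⁻ (f i) p x E fj∈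
      ... | inj₁ (_ , eq)          = ⊥-elim (off (j , eq))
      ... | inj₂ (inj₁ (eq , _))   = ⊥-elim (off (i , eq))
      ... | inj₂ (inj₂ ok)         = ok

    two-on-cycle : (T : Graph n) (C : Cycle T) → let open Cycle C in
      ∀ i → ∃[ j ] ∃[ l ] j ≢ l × Adj T (vertex i) (vertex j) × Adj T (vertex i) (vertex l)
    two-on-cycle T C i with view i
    ... | ‵fromℕ = zero , inject₁ (fromℕ _) , (λ ()) , Cycle.closing C , Graph.sym T (Cycle.step C (fromℕ _))
    ... | ‵inject₁ zero = suc zero , fromℕ _ , (λ ()) , Cycle.step C zero , Graph.sym T (Cycle.closing C)
    ... | ‵inject₁ (suc j) = suc (suc j) , inject₁ (inject₁ j) , skip j , Cycle.step C (suc j) ,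
                             Graph.sym T (Cycle.step C (inject₁ j))
      where
      skip : ∀ {m} (j : Fin m) → suc (suc j) ≢ inject₁ (inject₁ j)
      skip j eq = ℕ.m+1+n≢m (Fin.toℕ j) {1} (trans (ℕ.+-comm (Fin.toℕ j) 2)
        (trans (cong Fin.toℕ eq) (trans (Fin.toℕ-inject₁ (inject₁ j)) (Fin.toℕ-inject₁ j))))

    tree-isTree : (g : Grown G c E) → (∀ v → v ∈ verts c E) → IsTree (tree g)
    tree-isTree g all = tree-connected g all , λ C →
      acyclic g (_ , Cycle.vertex C , Cycle.distinct C , two-on-cycle (tree g) C)

-- Grafting paths onto a tree and the resulting degrees

module _ {n : ℕ} where

  private
    variable
      c p v x d : Fin n
      l l₁ l₂ l₃ l₄ : List (Fin n)

  graft : Fin n → List (Fin n) → Edges → Edges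
  graft p []      E = E
  graft p (x ∷ l) E = graft x l ((p , x) ∷ E)

  verts-graft : ∀ p l E → verts c (graft p l E) ↭ l ++ verts c E
  verts-graft p []      E = ↭-refl
  verts-graft p (x ∷ l) E = ↭-trans (verts-graft x l ((p , x) ∷ E)) (Perm.shift x l _)

  grown-graft : ∀ {G : Graph n} {E} → Grown G c E → p ∈ verts c E → Linked (Adj G) (p ∷ l) →
                Unique (l ++ verts c E) → Grown G c (graft p l E)
  grown-graft g p∈ [-]     un = g
  grown-graft {l = x ∷ l} g p∈ (e ∷ es) un@(x∉ ∷ _) =
    grown-graft (grow g p∈ (λ x∈ → All.lookup x∉ (∈-++⁺ʳ l x∈) refl) e) (here refl) es
      (Unique-resp-↭ (↭-sym (Perm.shift x l _)) un)

  incidence : Fin n → Fin n → Fin n → ℕ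
  incidence v p x with v Fin.≟ p | v Fin.≟ x
  ... | yes _ | _     = 1
  ... | no _  | yes _ = 1
  ... | no _  | no _  = 0

  -- The number of edges of the path `p ∷ l` at `v`, that is, what grafting this path adds to the
  -- degree of `v`.
  chain : Fin n → Fin n → List (Fin n) → ℕ
  chain v p []      = 0
  chain v p (x ∷ l) = incidence v p x + chain v x l

  length-nbrs : ∀ v p x E → length (nbrs v ((p , x) ∷ E)) ≡ incidence v p x + length (nbrs v E)
  length-nbrs v p x E with v Fin.≟ p | v Fin.≟ x
  ... | yes _ | _     = refl
  ... | no _  | yes _ = refl
  ... | no _  | no _  = refl

  length-nbrs-graft : ∀ v p l E → length (nbrs v (graft p l E)) ≡ chain v p l + length (nbrs v E)
  length-nbrs-graft v p []      E = refl
  length-nbrs-graft v p (x ∷ l) E = trans (length-nbrs-graft v x l _)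
    (trans (cong (chain v x l +_) (length-nbrs v p x E))
    (trans (sym (ℕ.+-assoc (chain v x l) _ _)) (cong (_+ length (nbrs v E)) (ℕ.+-comm (chain v x l) _))))

  incidence-out : v ≢ p → v ≢ x → incidence v p x ≡ 0
  incidence-out {v} {p} {x} v≢p v≢x with v Fin.≟ p | v Fin.≟ x
  ... | yes eq | _      = ⊥-elim (v≢p eq)
  ... | no _   | yes eq = ⊥-elim (v≢x eq)
  ... | no _   | no _   = refl

  incidence-fst : ∀ v x → incidence v v x ≡ 1
  incidence-fst v x with v Fin.≟ v
  ... | yes _ = refl
  ... | no ¬r = ⊥-elim (¬r refl)

  incidence-snd : ∀ p v → incidence v p v ≡ 1
  incidence-snd p v with v Fin.≟ p | v Fin.≟ v
  ... | yes _ | _     = refl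
  ... | no _  | yes _ = refl
  ... | no _  | no ¬r = ⊥-elim (¬r refl)

  chain-out : ∀ l → v ∉ p ∷ l → chain v p l ≡ 0
  chain-out []      _  = refl
  chain-out (x ∷ l) v∉ = cong₂ _+_ (incidence-out (v∉ ∘ here) (v∉ ∘ there ∘ here)) (chain-out l (v∉ ∘ there))

  chain-inner : ∀ zs {us} → Unique (p ∷ zs ++ v ∷ d ∷ us) → chain v p (zs ++ v ∷ d ∷ us) ≡ 2
  chain-inner {p} {v} {d} [] {us} (p∉ ∷ v∉ ∷ _) = cong₂ _+_ (incidence-snd p v)
    (cong₂ _+_ (incidence-fst v d) (chain-out us (λ v∈ → All.lookup v∉ v∈ refl)))
  chain-inner (z ∷ zs) (p∉ ∷ un@(z∉ ∷ _)) = cong₂ _+_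
    (incidence-out (λ eq → All.lookup p∉ (∈-++⁺ʳ (z ∷ zs) (here refl)) (sym eq))
                   (λ eq → All.lookup z∉ (∈-++⁺ʳ zs (here refl)) (sym eq)))
    (chain-inner zs un)

  -- A list with at most one element, so that an empty leg contributes no end.
  end : List (Fin n) → List (Fin n)
  end []          = []
  end (x ∷ [])    = x ∷ []
  end (x ∷ y ∷ l) = end (y ∷ l)

  length-end : ∀ l → length (end l) ≤ 1
  length-end []          = z≤n
  length-end (x ∷ [])    = s≤s z≤n
  length-end (x ∷ y ∷ l) = length-end (y ∷ l)

  end-or-inner : ∀ l → v ∈ l → v ∈ end l ⊎ (∃[ zs ] ∃[ d ] ∃[ us ] l ≡ zs ++ v ∷ d ∷ us)
  end-or-inner (x ∷ [])    (here refl) = inj₁ (here refl)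
  end-or-inner (x ∷ y ∷ l) (here refl) = inj₂ ([] , y , l , refl)
  end-or-inner (x ∷ y ∷ l) (there v∈) with end-or-inner (y ∷ l) v∈
  ... | inj₁ v∈′               = inj₁ v∈′
  ... | inj₂ (zs , d , us , eq) = inj₂ (x ∷ zs , d , us , cong (x ∷_) eq)

  -- Only finitely many lists over `Fin n` have length at most `k`. This makes the existence of a
  -- spanning spider decidable.
  exists-short? : ∀ {P : List (Fin n) → Set} → (∀ l → Dec (P l)) → ∀ k → Dec (∃[ l ] length l ≤ k × P l)
  exists-short? P? zero = map′ (λ p → [] , z≤n , p) (λ { ([] , _ , p) → p }) (P? [])
  exists-short? P? (suc k) = map′
    (λ { (inj₁ p) → [] , z≤n , p ; (inj₂ (v , l , l≤k , p)) → v ∷ l , s≤s l≤k , p })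
    (λ { ([] , _ , p) → inj₁ p ; (v ∷ l , s≤s l≤k , p) → inj₂ (v , l , l≤k , p) })
    (P? [] ⊎-dec any? (λ v → exists-short? (λ l → P? (v ∷ l)) k))

  root∈verts : ∀ E → c ∈ verts c E
  root∈verts []      = here refl
  root∈verts (_ ∷ E) = there (root∈verts E)

-- Deciding the existence of a spanning spider and reading off its tree

module SpanningSpiders {n : ℕ} (G : Graph n) where
  open Paths G
  open Legs G using (Spans; spans; arrangement; swap₁₂; swap₂₃; swap₃₄; solve; _⊕_; _⊜_)
  open Extremal G

  -- A spanning spider described by explicit lists and decidable conditions.
  record Spanning (c : Fin n) (l₁ l₂ l₃ l₄ : List (Fin n)) : Set where
    constructor spanning
    field
      linked₁  : Linked _~_ (c ∷ l₁)
      linked₂  : Linked _~_ (c ∷ l₂)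
      linked₃  : Linked _~_ (c ∷ l₃)
      linked₄  : Linked _~_ (c ∷ l₄)
      distinct : Unique (c ∷ l₁ ++ l₂ ++ l₃ ++ l₄)
      order    : length (c ∷ l₁ ++ l₂ ++ l₃ ++ l₄) ≡ n

  spanning? : ∀ c l₁ l₂ l₃ l₄ → Dec (Spanning c l₁ l₂ l₃ l₄)
  spanning? c l₁ l₂ l₃ l₄ = map′
    (λ (a , b , d , e , f , g) → spanning a b d e f g) (λ (spanning a b d e f g) → a , b , d , e , f , g)
    (linked? (adj? G) _ ×-dec linked? (adj? G) _ ×-dec linked? (adj? G) _ ×-dec linked? (adj? G) _
      ×-dec allPairs? (λ x y → ¬? (x Fin.≟ y)) _ ×-dec (_ ≟ n))

  ShortSpanning : Set
  ShortSpanning = ∃[ c ] ∃[ l₁ ] length l₁ ≤ n × (∃[ l₂ ] length l₂ ≤ n × (∃[ l₃ ] length l₃ ≤ n ×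
                  (∃[ l₄ ] length l₄ ≤ n × Spanning c l₁ l₂ l₃ l₄)))

  shortSpanning? : Dec ShortSpanning
  shortSpanning? = any? λ c → exists-short? (λ l₁ → exists-short? (λ l₂ → exists-short? (λ l₃ →
                   exists-short? (λ l₄ → spanning? c l₁ l₂ l₃ l₄) n) n) n) n

  path-linked : ∀ {a b l} → Path a l b → Linked _~_ l
  path-linked [-]             = [-]
  path-linked (e ∷ [-])       = e ∷ [-]
  path-linked (e ∷ p@(_ ∷ _)) = e ∷ path-linked p

  linked-leg : ∀ {c l x} → c ⟨ c ∷ l ⟩ x → ∃[ l′ ] Linked _~_ (c ∷ l′) × l′ ↭ l
  linked-leg (_ , [-]       , τ) = _ , [-]                 , Perm.drop-∷ τ
  linked-leg (_ , p@(_ ∷ _) , τ) = _ , path-linked p       , Perm.drop-∷ τ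

  shorten : ∀ {V} → Unique V → length V ≡ n → SpiderOn V → ShortSpanning
  shorten {V} un |V|≡n (spider {c} p₁ p₂ p₃ p₄ σ) =
    let l₁ , k₁ , τ₁ = linked-leg p₁
        l₂ , k₂ , τ₂ = linked-leg p₂
        l₃ , k₃ , τ₃ = linked-leg p₃
        l₄ , k₄ , τ₄ = linked-leg p₄
        τ : c ∷ l₁ ++ l₂ ++ l₃ ++ l₄ ↭ V
        τ = ↭-trans (prep c (Perm.++⁺ τ₁ (Perm.++⁺ τ₂ (Perm.++⁺ τ₃ τ₄)))) σ
        |l|≡n = trans (Perm.↭-length τ) |V|≡n
        b₁ , b₂ , b₃ , b₄ = parts (length l₁) (length l₂) (length l₃) (length l₄)
                              (trans (cong suc (sym (length-++₄ l₁ l₂ l₃ l₄))) |l|≡n)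
    in c , l₁ , b₁ , l₂ , b₂ , l₃ , b₃ , l₄ , b₄ , spanning k₁ k₂ k₃ k₄ (Unique-resp-↭ (↭-sym τ) un) |l|≡n
    where
    parts : ∀ a b d e → suc (a + (b + (d + e))) ≡ n → a ≤ n × b ≤ n × d ≤ n × e ≤ n
    parts a b d e refl =
      ℕ.m≤n⇒m≤1+n (ℕ.m≤m+n a _) ,
      ℕ.m≤n⇒m≤1+n (ℕ.≤-trans (ℕ.m≤m+n b _) (ℕ.m≤n+m _ a)) ,
      ℕ.m≤n⇒m≤1+n (ℕ.≤-trans (ℕ.≤-trans (ℕ.m≤m+n d e) (ℕ.m≤n+m _ b)) (ℕ.m≤n+m _ a)) ,
      ℕ.m≤n⇒m≤1+n (ℕ.≤-trans (ℕ.≤-trans (ℕ.m≤n+m e d) (ℕ.m≤n+m _ b)) (ℕ.m≤n+m _ a))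

  inner-chain : ∀ {c v l₁ l₂ l₃ l₄ U} → Unique U → Spans U c l₁ l₂ l₃ l₄ → v ≢ c → v ∈ l₁ → v ∉ end l₁ →
    chain v c l₁ ≡ 2 × chain v c l₂ ≡ 0 × chain v c l₃ ≡ 0 × chain v c l₄ ≡ 0
  inner-chain {c} {v} {l₁} {l₂} {l₃} {l₄} un σ v≢c v∈ v∉end with end-or-inner l₁ v∈
  ... | inj₁ v∈end               = ⊥-elim (v∉end v∈end)
  ... | inj₂ (zs , _ , _ , refl) =
    chain-inner zs (Unique-++⁻ˡ (c ∷ l₁) un′) ,
    chain-out l₂ (off (rest ∘ ∈-++⁺ˡ)) ,
    chain-out l₃ (off (rest ∘ ∈-++⁺ʳ l₂ ∘ ∈-++⁺ˡ)) ,
    chain-out l₄ (off (rest ∘ ∈-++⁺ʳ l₂ ∘ ∈-++⁺ʳ l₃))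
    where
    un′ : Unique (c ∷ l₁ ++ l₂ ++ l₃ ++ l₄)
    un′ = Unique-resp-↭ (↭-sym (arrangement σ)) un
    rest : v ∉ l₂ ++ l₃ ++ l₄
    rest v∈′ = Unique-disjoint (c ∷ l₁) un′ (there v∈) v∈′
    off : ∀ {l} → v ∉ l → v ∉ c ∷ l
    off v∉ (here eq)  = v≢c eq
    off v∉ (there v∈) = v∉ v∈

  module _ {c l₁ l₂ l₃ l₄} (S : Spanning c l₁ l₂ l₃ l₄) where
    open Spanning S

    E₄ E₃ E₂ E : Edges
    E₄ = graft c l₄ []
    E₃ = graft c l₃ E₄
    E₂ = graft c l₂ E₃
    E  = graft c l₁ E₂

    verts-E₄ : verts c E₄ ↭ l₄ ++ c ∷ []
    verts-E₄ = verts-graft c l₄ []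

    verts-E₃ : verts c E₃ ↭ l₃ ++ l₄ ++ c ∷ []
    verts-E₃ = ↭-trans (verts-graft c l₃ E₄) (Perm.++⁺ˡ l₃ verts-E₄)

    verts-E₂ : verts c E₂ ↭ l₂ ++ l₃ ++ l₄ ++ c ∷ []
    verts-E₂ = ↭-trans (verts-graft c l₂ E₃) (Perm.++⁺ˡ l₂ verts-E₃)

    rooted : Unique (l₁ ++ l₂ ++ l₃ ++ l₄ ++ c ∷ [])
    rooted = Unique-resp-↭ (solve 5 (λ c l₁ l₂ l₃ l₄ → (c ⊕ l₁ ⊕ l₂ ⊕ l₃ ⊕ l₄) ⊜ (l₁ ⊕ l₂ ⊕ l₃ ⊕ l₄ ⊕ c)) ↭-refl
      (c ∷ []) l₁ l₂ l₃ l₄) distinct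

    grown : Grown G c E
    grown = grown-graft (grown-graft (grown-graft (grown-graft root (here refl)
        linked₄ (Unique-++⁻ʳ l₃ (Unique-++⁻ʳ l₂ (Unique-++⁻ʳ l₁ rooted))))
        (root∈verts E₄) linked₃ (Unique-resp-↭ (Perm.++⁺ˡ l₃ (↭-sym verts-E₄))
          (Unique-++⁻ʳ l₂ (Unique-++⁻ʳ l₁ rooted))))
        (root∈verts E₃) linked₂ (Unique-resp-↭ (Perm.++⁺ˡ l₂ (↭-sym verts-E₃)) (Unique-++⁻ʳ l₁ rooted)))
        (root∈verts E₂) linked₁ (Unique-resp-↭ (Perm.++⁺ˡ l₁ (↭-sym verts-E₂)) rooted)

    everywhere : ∀ v → v ∈ c ∷ l₁ ++ l₂ ++ l₃ ++ l₄
    everywhere v = decidable-stable (v ∈? _) λ v∉ →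
      ℕ.<⇒≱ (ℕ.≤-reflexive (cong suc (sym order))) (Unique⇒length≤n (¬Any⇒All¬ _ v∉ ∷ distinct))

    covers : ∀ v → v ∈ verts c E
    covers v = Perm.∈-resp-↭ (↭-sym (↭-trans (verts-graft c l₁ E₂) (Perm.++⁺ˡ l₁ verts-E₂)))
      (Perm.∈-resp-↭ (solve 5 (λ c l₁ l₂ l₃ l₄ → (c ⊕ l₁ ⊕ l₂ ⊕ l₃ ⊕ l₄) ⊜ (l₁ ⊕ l₂ ⊕ l₃ ⊕ l₄ ⊕ c)) ↭-refl
        (c ∷ []) l₁ l₂ l₃ l₄) (everywhere v))

    T : Graph n
    T = tree grown

    ends : List (Fin n)
    ends = end l₁ ++ end l₂ ++ end l₃ ++ end l₄

    whole : Spans (c ∷ l₁ ++ l₂ ++ l₃ ++ l₄) c l₁ l₂ l₃ l₄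
    whole = spans ↭-refl

    degree-T : ∀ v → degree T v ≡ chain v c l₁ + (chain v c l₂ + (chain v c l₃ + (chain v c l₄ + 0)))
    degree-T v = trans (degree-tree grown v)
      (trans (length-nbrs-graft v c l₁ E₂) (cong (chain v c l₁ +_)
      (trans (length-nbrs-graft v c l₂ E₃) (cong (chain v c l₂ +_)
      (trans (length-nbrs-graft v c l₃ E₄) (cong (chain v c l₃ +_) (length-nbrs-graft v c l₄ [])))))))

    unmarked-degree : ∀ v → v ∉ c ∷ ends → degree T v ≡ 2
    unmarked-degree v v∉ with everywhere v
    ... | here refl = ⊥-elim (v∉ (here refl))
    ... | there v∈ with ∈-++⁻ l₁ v∈
    ...   | inj₁ v∈₁ =
      let p₁ , p₂ , p₃ , p₄ = inner-chain distinct whole (v∉ ∘ here) v∈₁ (v∉ ∘ there ∘ ∈-++⁺ˡ)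
      in trans (degree-T v) (sum₄ p₁ p₂ p₃ p₄)
    ...   | inj₂ v∈′ with ∈-++⁻ l₂ v∈′
    ...     | inj₁ v∈₂ =
      let p₂ , p₁ , p₃ , p₄ = inner-chain distinct (swap₁₂ whole) (v∉ ∘ here) v∈₂
                                (v∉ ∘ there ∘ ∈-++⁺ʳ (end l₁) ∘ ∈-++⁺ˡ)
      in trans (degree-T v) (sum₄ p₁ p₂ p₃ p₄)
    ...     | inj₂ v∈″ with ∈-++⁻ l₃ v∈″
    ...       | inj₁ v∈₃ =
      let p₃ , p₁ , p₂ , p₄ = inner-chain distinct (swap₁₂ (swap₂₃ whole)) (v∉ ∘ here) v∈₃
                                (v∉ ∘ there ∘ ∈-++⁺ʳ (end l₁) ∘ ∈-++⁺ʳ (end l₂) ∘ ∈-++⁺ˡ)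
      in trans (degree-T v) (sum₄ p₁ p₂ p₃ p₄)
    ...       | inj₂ v∈₄ =
      let p₄ , p₁ , p₂ , p₃ = inner-chain distinct (swap₁₂ (swap₂₃ (swap₃₄ whole))) (v∉ ∘ here) v∈₄
                                (v∉ ∘ there ∘ ∈-++⁺ʳ (end l₁) ∘ ∈-++⁺ʳ (end l₂) ∘ ∈-++⁺ʳ (end l₃))
      in trans (degree-T v) (sum₄ p₁ p₂ p₃ p₄)

    leaf? : ∀ v → Dec (degree T v ≡ 1)
    leaf? v = degree T v ≟ 1

    branch? : ∀ v → Dec (3 ≤ degree T v)
    branch? v = 3 ≤? degree T v

    -- All vertices except the centre and the at most four ends of legs have degree 2, so the
    -- disjoint sets of leaves and branch vertices fit among these five.
    few : ∣ L T ∣ + ∣ B T ∣ ≤ 5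
    few = begin
      ∣ L T ∣ + ∣ B T ∣                       ≡⟨ cong₂ _+_ (∣tabulate∣ leaf? (λ v → v)) (∣tabulate∣ branch? (λ v → v)) ⟩
      length Ls + length Bs                   ≡⟨ length-++ Ls ⟨
      length (Ls ++ Bs)                       ≤⟨ Unique⇒length≤ (Unique.++⁺ (Unique.filter⁺ leaf? (Unique.allFin⁺ n))
                                                   (Unique.filter⁺ branch? (Unique.allFin⁺ n)) disjoint) marked ⟩
      suc (length ends)                       ≡⟨ cong suc (length-++₄ (end l₁) (end l₂) (end l₃) (end l₄)) ⟩
      suc (length (end l₁) + (length (end l₂) + (length (end l₃) + length (end l₄))))
        ≤⟨ s≤s (ℕ.+-mono-≤ (length-end l₁) (ℕ.+-mono-≤ (length-end l₂) (ℕ.+-mono-≤ (length-end l₃) (length-end l₄)))) ⟩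
      5                                       ∎
      where
      open ℕ.≤-Reasoning
      Ls = filter leaf? (allFin n)
      Bs = filter branch? (allFin n)
      isLeaf : ∀ {v} → v ∈ Ls → degree T v ≡ 1
      isLeaf v∈ = proj₂ (∈-filter⁻ leaf? {xs = allFin n} v∈)
      isBranch : ∀ {v} → v ∈ Bs → 3 ≤ degree T v
      isBranch v∈ = proj₂ (∈-filter⁻ branch? {xs = allFin n} v∈)
      disjoint : ∀ {v} → ¬ (v ∈ Ls × v ∈ Bs)
      disjoint (v∈L , v∈B) = ℕ.<⇒≢ (ℕ.≤-trans (s≤s (s≤s z≤n)) (isBranch v∈B)) (sym (isLeaf v∈L))
      marked : ∀ {v} → v ∈ Ls ++ Bs → v ∈ c ∷ ends
      marked {v} v∈ = decidable-stable (v ∈? _) λ v∉ → contra (∈-++⁻ Ls v∈) (unmarked-degree v v∉)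
        where
        contra : v ∈ Ls ⊎ v ∈ Bs → degree T v ≢ 2
        contra (inj₁ v∈L) eq with () ← trans (sym (isLeaf v∈L)) eq
        contra (inj₂ v∈B) eq = ℕ.<⇒≢ (isBranch v∈B) (sym eq)

    spanningTree : T IsSpanningTreeOf G
    spanningTree = tree-isTree grown covers , nbrs-adjacent grown

theorem1p7 : ∀ (n : ℕ) (G : Graph n) → Connected G → K₁, 5 -Free G →
    [ n ∸ 1 ] ≤⁺ σ 4 G →
    ∃[ T ] T IsSpanningTreeOf G × ∣ L T ∣ + ∣ B T ∣ ≤ 5
theorem1p7 n G conn free bound =
  -- The extremal argument only refutes the absence of a spanning spider; the decidable bounded
  -- search turns this into an actual one.
  let _ , _ , _ , _ , _ , _ , _ , _ , _ , S = decidable-stable shortSpanning? λ ¬short →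
        no-spider-absurd conn free bound (λ un eq sp → ¬short (shorten un eq sp))
  in T S , spanningTree S , few S
  where
  open Extremal G
  open SpanningSpiders G
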